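{- Let $\mathbb F$ be a field, let $d\ge 3$ and $n\ge 1$ be integers, and let $T\in(\mathbb F^n)^{\otimes d}$ be an arbitrary $d$-mode tensor. Then $$\widetilde{\mathrm R}(T)\le n^{(d-1)\tau(d)}.$$
   Context: A $d$-mode tensor over $\mathbb F$ is a polynomial in variables partitioned into $d$ nonempty disjoint sets $X_1,\dots,X_d$ (modes) all of whose monomials contain exactly one variable from each mode, with degree one; $(\mathbb F^n)^{\otimes d}$ denotes those in which each mode has $n$ variables. The Kronecker product $S\otimes T$ of $d$-mode tensors with modes $X_i$ and $Y_i$ is the polynomial product $ST$, viewed as a $d$-mode tensor with modes $X_i\times Y_i$ (a product $xy$ with $x\in X_i$, $y\in Y_i$ is regarded as one variable); $T^{\otimes k}$ is the $k$-fold Kronecker power. The rank $\mathrm R(T)$ is the least number of products $\ell_1\cdots\ell_d$ ($\ell_j$ a linear form in $X_j$) with sum $T$. The asymptotic rank is $\widetilde{\mathrm R}(T)=\lim_{k\to\infty}\mathrm R(T^{\otimes k})^{1/k}$. For a graph $G$, a vertex $v$ and $n\in\mathbb N$, let $I(v)$ be the set of edges incident to $v$ and $X^{(v)}=\{x^{(v)}_g: g\colon I(v)\to[n]\}$; the graph tensor with modes $X^{(v)}$, $v\in V(G)$, is $T_{G,n}=\sum_{f\colon E(G)\to[n]}\prod_{v\in V(G)}x^{(v)}_{f|_{I(v)}}$. Put $\omega(G)=\inf\{\beta:\mathrm R(T_{G,n})=O(n^\beta)\text{ as }n\to\infty\}$ and $\tau(G)=\omega(G)/|E(G)|$. Finally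 $\tau(d)=\tau(K_d)=\omega(K_d)/\binom d2$, where $K_d$ is the complete graph on $d$ vertices. -}

module Defs where

open import Algebra.Apartness.Bundles using (HeytingCommutativeRing; HeytingField)
open import Algebra.Bundles using (CommutativeRing; Semiring)
import Algebra.Definitions.RawSemiring as RawSemiring
import Algebra.Properties.Monoid.Mult as Mult
open import Data.Bool.Base using (if_then_else_)
open import Data.Empty using (⊥-elim)
open import Data.Fin.Base as Fin using (Fin; finToFun)
import Data.Fin.Properties as Fin
open import Data.Integer.Base as ℤ using (ℤ; +_; -[1+_]; +≤+; -≤+)
import Data.Integer.Properties as ℤ
open import Data.List.Base as List using (List)
open import Data.Nat.Base as ℕ using (ℕ; zero; suc; NonZero; z≤n; s≤s)
import Data.Nat.Properties as ℕ
open import Data.Product.Base using (Σ; ∃-syntax; _×_; _,_; proj₁; proj₂)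
open import Data.Rational.Base as ℚ using (ℚ; mkℚ; ↥_; ↧ₙ_; 0ℚ; 1ℚ)
import Data.Rational.Properties as ℚ
open import Data.Rational.Unnormalised.Base using (mkℚᵘ; *≤*; *<*)
import Data.Rational.Unnormalised.Properties as ℚᵘ
open import Data.Sum.Base using (_⊎_; inj₁; inj₂)
open import Data.Unit.Base using (⊤)
open import Data.Vec.Base as Vec using (Vec)
import Data.Vec.Properties as Vec
open import Level using (0ℓ; _⊔_)
open import Relation.Binary.Core using (Rel)
open import Relation.Binary.Definitions using (Decidable; DecidableEquality; tri<; tri≈; tri>; Symmetric; Irreflexive)
open import Relation.Binary.PropositionalEquality
open import Relation.Nullary using (¬_; does)
open import Relation.Nullary.Decidable using (_×-dec_; _⊎-dec_; ¬?)

open RawSemiring (Semiring.rawSemiring (CommutativeRing.semiring ℚ.+-*-commutativeRing)) public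
  using () renaming (_^_ to _^ℚ_)

fromℕ : ℕ → ℚ
fromℕ n = + n ℚ./ 1

-- Real numbers as Dedekind's lower cuts: _∋_ q says that q is less than
-- the real.
record ℝ : Set₁ where
  field
    _∋_       : ℚ → Set
    inhabited : ∃[ q ] _∋_ q
    bounded   : ∃[ q ] ¬ _∋_ q
    lower     : ∀ {p q} → p ℚ.< q → _∋_ q → _∋_ p
    rounded   : ∀ {p} → _∋_ p → ∃[ q ] (p ℚ.< q × _∋_ q)

open ℝ public using (_∋_)

infix 4 _≤_ _≃_

_≤_ : ℝ → ℝ → Set
x ≤ y = ∀ q → x ∋ q → y ∋ q

_≃_ : ℝ → ℝ → Set
x ≃ y = x ≤ y × y ≤ x

private
  q-1<q : ∀ q → q ℚ.- 1ℚ ℚ.< q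
  q-1<q q = subst (q ℚ.- 1ℚ ℚ.<_) (ℚ.+-identityʳ q)
    (ℚ.+-monoʳ-< q (ℚ.negative⁻¹ (ℚ.- 1ℚ)))

  +-cancel : ∀ q e → (q ℚ.+ e) ℚ.- e ≡ q
  +-cancel q e = trans (ℚ.+-assoc q e (ℚ.- e))
    (trans (cong (q ℚ.+_) (ℚ.+-inverseʳ e)) (ℚ.+-identityʳ q))

  -+cancel : ∀ q e → (q ℚ.- e) ℚ.+ e ≡ q
  -+cancel q e = trans (ℚ.+-assoc q (ℚ.- e) e)
    (trans (cong (q ℚ.+_) (ℚ.+-inverseˡ e)) (ℚ.+-identityʳ q))

fromℚ : ℚ → ℝ
fromℚ p = record
  { _∋_       = ℚ._< p
  ; inhabited = p ℚ.- 1ℚ , q-1<q p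
  ; bounded   = p , ℚ.<-irrefl refl
  ; lower     = ℚ.<-trans
  ; rounded   = λ q<p → let m , q<m , m<p = ℚ.<-dense q<p in m , q<m , m<p
  }

infixl 6 _+_

_+_ : ℝ → ℚ → ℝ
x + e = record
  { _∋_       = λ q → x ∋ (q ℚ.- e)
  ; inhabited = let q , x∋q = X.inhabited in
      q ℚ.+ e , subst (x ∋_) (sym (+-cancel q e)) x∋q
  ; bounded   = let q , x∌q = X.bounded in
      q ℚ.+ e , λ h → x∌q (subst (x ∋_) (+-cancel q e) h)
  ; lower     = λ p<q → X.lower (ℚ.+-monoˡ-< (ℚ.- e) p<q)
  ; rounded   = λ {p} h → let q , p<q , x∋q = X.rounded h in
      q ℚ.+ e ,
      subst (ℚ._< q ℚ.+ e) (-+cancel p e) (ℚ.+-monoˡ-< e p<q) ,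
      subst (x ∋_) (sym (+-cancel q e)) x∋q
  }
  where module X = ℝ x

scale : (c : ℚ) .{{_ : ℚ.Positive c}} → ℝ → ℝ
scale c x = record
  { _∋_       = λ q → x ∋ (q ℚ.* c⁻¹)
  ; inhabited = let q , x∋q = X.inhabited in
      q ℚ.* c , subst (x ∋_) (sym (*-cancel q)) x∋q
  ; bounded   = let q , x∌q = X.bounded in
      q ℚ.* c , λ h → x∌q (subst (x ∋_) (*-cancel q) h)
  ; lower     = λ p<q → X.lower (ℚ.*-monoˡ-<-pos c⁻¹ p<q)
  ; rounded   = λ {p} h → let q , p<q , x∋q = X.rounded h in
      q ℚ.* c ,
      subst (ℚ._< q ℚ.* c) (÷*cancel p) (ℚ.*-monoˡ-<-pos c p<q) ,
      subst (x ∋_) (sym (*-cancel q)) x∋q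
  }
  where
  module X = ℝ x
  instance
    c≢0 : ℚ.NonZero c
    c≢0 = ℚ.pos⇒nonZero c
  c⁻¹ : ℚ
  c⁻¹ = ℚ.1/ c
  instance
    c⁻¹>0 : ℚ.Positive c⁻¹
    c⁻¹>0 = ℚ.1/pos⇒pos c
  *-cancel : ∀ q → (q ℚ.* c) ℚ.* c⁻¹ ≡ q
  *-cancel q = trans (ℚ.*-assoc q c c⁻¹)
    (trans (cong (q ℚ.*_) (ℚ.*-inverseʳ c)) (ℚ.*-identityʳ q))
  ÷*cancel : ∀ q → (q ℚ.* c⁻¹) ℚ.* c ≡ q
  ÷*cancel q = trans (ℚ.*-assoc q c⁻¹ c)
    (trans (cong (q ℚ.*_) (ℚ.*-inverseˡ c)) (ℚ.*-identityʳ q))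

infixr 7 _·_
infixl 7 _/_

_·_ : ℕ → ℝ → ℝ
zero      · x = fromℚ 0ℚ
k@(suc _) · x = scale (fromℕ k) {{ℚ.normalize-pos k 1}} x

-- Total, with x / 0 = 0.
_/_ : ℝ → ℕ → ℝ
x / zero      = fromℚ 0ℚ
x / k@(suc _) = scale (+ 1 ℚ./ k) {{ℚ.normalize-pos 1 k}} x

posPart negPart : ℤ → ℕ
posPart (+ n)    = n
posPart -[1+ n ] = 0
negPart (+ n)    = 0
negPart -[1+ n ] = suc n

-- q ≤ n ^ s for n ≥ 1 and s = a / b: if q > 0, this says q ^ b ≤ n ^ a, where
-- the factor n ^ (- a) is moved to the left-hand side when a < 0.
_≤[_^_] : ℚ → ℕ → ℚ → Set
q ≤[ n ^ s ] =
  q ℚ.≤ 0ℚ ⊎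
  (q ^ℚ (↧ₙ s)) ℚ.* (fromℕ n ^ℚ negPart (↥ s)) ℚ.≤ fromℕ n ^ℚ posPart (↥ s)

private
  1≤fromℕ : ∀ m → 1ℚ ℚ.≤ fromℕ (suc m)
  1≤fromℕ m = ℚ.toℚᵘ-cancel-≤ (ℚᵘ.≤-respʳ-≃ (ℚᵘ.≃-sym (ℚ.toℚᵘ-fromℚᵘ (mkℚᵘ (+ suc m) 0)))
    (*≤* (ℤ.*-monoʳ-≤-nonNeg (+ 1) {+ 1} {+ suc m} (+≤+ (s≤s z≤n)))))

  0≤1 : 0ℚ ℚ.≤ 1ℚ
  0≤1 = ℚ.nonNegative⁻¹ 1ℚ

  *-mono : ∀ {p q r s} → 0ℚ ℚ.≤ q → 0ℚ ℚ.≤ r → p ℚ.≤ q → r ℚ.≤ s →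
           p ℚ.* r ℚ.≤ q ℚ.* s
  *-mono {p} {q} {r} {s} 0≤q 0≤r p≤q r≤s = ℚ.≤-trans
    (ℚ.*-monoʳ-≤-nonNeg r {{ℚ.nonNegative 0≤r}} p≤q)
    (ℚ.*-monoˡ-≤-nonNeg q {{ℚ.nonNegative 0≤q}} r≤s)

  1≤^ : ∀ {q} k → 1ℚ ℚ.≤ q → 1ℚ ℚ.≤ q ^ℚ k
  1≤^ zero    _   = ℚ.≤-refl
  1≤^ {q} (suc k) 1≤q = *-mono (ℚ.≤-trans 0≤1 1≤q) 0≤1 1≤q (1≤^ k 1≤q)

  ^-monoʳ : ∀ {q k l} → 1ℚ ℚ.≤ q → k ℕ.≤ l → q ^ℚ k ℚ.≤ q ^ℚ l
  ^-monoʳ {l = l} 1≤q z≤n       = 1≤^ l 1≤q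
  ^-monoʳ {q} {suc k} 1≤q (s≤s k≤l) =
    *-mono 0≤q (ℚ.≤-trans 0≤1 (1≤^ k 1≤q)) ℚ.≤-refl (^-monoʳ 1≤q k≤l)
    where 0≤q = ℚ.≤-trans 0≤1 1≤q

  ^-monoˡ-< : ∀ {p q} k .{{_ : NonZero k}} → 1ℚ ℚ.≤ p → p ℚ.< q → p ^ℚ k ℚ.< q ^ℚ k
  ^-monoˡ-< {p} {q} 1 1≤p p<q =
    subst₂ ℚ._<_ (sym (ℚ.*-identityʳ p)) (sym (ℚ.*-identityʳ q)) p<q
  ^-monoˡ-< {p} {q} (suc k@(suc _)) 1≤p p<q = ℚ.<-≤-trans
    (ℚ.*-monoˡ-<-pos (p ^ℚ k) {{ℚ.positive 0<p^k}} p<q)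
    (ℚ.*-monoˡ-≤-nonNeg q {{ℚ.nonNegative 0≤q}}
      (ℚ.<⇒≤ (^-monoˡ-< k 1≤p p<q)))
    where
    0<p^k : 0ℚ ℚ.< p ^ℚ k
    0<p^k = ℚ.<-≤-trans (ℚ.positive⁻¹ 1ℚ) (1≤^ k 1≤p)
    0≤q : 0ℚ ℚ.≤ q
    0≤q = ℚ.≤-trans 0≤1 (ℚ.≤-trans 1≤p (ℚ.<⇒≤ p<q))

  ^-*-assoc : ∀ q k l → (q ^ℚ k) ^ℚ l ≡ q ^ℚ (l ℕ.* k)
  ^-*-assoc q k l = Mult.×-assocˡ ℚ.*-1-monoid q l k

  posPart-bound : ∀ s B → s ℚ.< fromℕ B → posPart (↥ s) ℕ.≤ ↧ₙ s ℕ.* B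
  posPart-bound (mkℚ -[1+ _ ] _ _)  B _ = z≤n
  posPart-bound s@(mkℚ (+ a) b-1 _) B s<B = ℤ.drop‿+≤+ (ℤ.<⇒≤ a<bB)
    where
    a<bB : + a ℤ.< + (suc b-1 ℕ.* B)
    a<bB with ℚᵘ.<-respʳ-≃ (ℚ.toℚᵘ-fromℚᵘ (mkℚᵘ (+ B) 0)) (ℚ.toℚᵘ-mono-< s<B)
    ... | *<* h = subst₂ ℤ._<_ (ℤ.*-identityʳ (+ a))
                    (trans (sym (ℤ.pos-* B (suc b-1))) (cong +_ (ℕ.*-comm B (suc b-1)))) h

  q<bound : ∀ q → q ℚ.< fromℕ (suc ℤ.∣ ↥ q ∣)
  q<bound q@(mkℚ a b-1 _) = ℚ.toℚᵘ-cancel-<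
    (ℚᵘ.<-respʳ-≃ (ℚᵘ.≃-sym (ℚ.toℚᵘ-fromℚᵘ (mkℚᵘ (+ N) 0))) (*<* a<))
    where
    N = suc ℤ.∣ a ∣
    i≤∣i∣ : ∀ i → i ℤ.≤ + ℤ.∣ i ∣
    i≤∣i∣ (+ n)    = ℤ.≤-refl
    i≤∣i∣ -[1+ n ] = -≤+
    a< : a ℤ.* + 1 ℤ.< + N ℤ.* + suc b-1
    a< = subst₂ ℤ._<_ (sym (ℤ.*-identityʳ a)) (ℤ.pos-* N (suc b-1))
      (ℤ.≤-<-trans (i≤∣i∣ a) (ℤ.+<+ (ℕ.m≤m*n N (suc b-1))))

  power-bound : ∀ m B {q s} → s ℚ.< fromℕ B → q ≤[ suc m ^ s ] →
                q ℚ.≤ fromℕ (suc m) ^ℚ B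
  power-bound m B s<B (inj₁ q≤0) =
    ℚ.≤-trans q≤0 (ℚ.≤-trans 0≤1 (1≤^ B (1≤fromℕ m)))
  power-bound m B {q} {s} s<B (inj₂ h) = ℚ.≮⇒≥ absurd
    where
    n = fromℕ (suc m)
    N = n ^ℚ B
    b = ↧ₙ s
    1≤N : 1ℚ ℚ.≤ N
    1≤N = 1≤^ B (1≤fromℕ m)
    absurd : ¬ (N ℚ.< q)
    absurd N<q = ℚ.<-irrefl refl (begin-strict
      N ^ℚ b                               <⟨ ^-monoˡ-< b 1≤N N<q ⟩
      q ^ℚ b                               ≡⟨ ℚ.*-identityʳ _ ⟨
      (q ^ℚ b) ℚ.* 1ℚ                      ≤⟨ *-mono 0≤q^b 0≤1 ℚ.≤-refl
                                                (1≤^ (negPart (↥ s)) (1≤fromℕ m)) ⟩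
      (q ^ℚ b) ℚ.* (n ^ℚ negPart (↥ s))    ≤⟨ h ⟩
      n ^ℚ posPart (↥ s)                   ≤⟨ ^-monoʳ (1≤fromℕ m) (posPart-bound s B s<B) ⟩
      n ^ℚ (b ℕ.* B)                       ≡⟨ ^-*-assoc n B b ⟨
      N ^ℚ b                               ∎)
      where
      open ℚ.≤-Reasoning
      0≤q^b : 0ℚ ℚ.≤ q ^ℚ b
      0≤q^b = ℚ.≤-trans 0≤1 (1≤^ b (ℚ.≤-trans 1≤N (ℚ.<⇒≤ N<q)))

infixr 8 _^_

-- n ^ x is the supremum of n ^ s over the rationals s < x.  The value
-- 0 ^ x = 0 is meaningful only for x > 0.
_^_ : ℕ → ℝ → ℝ
zero      ^ x = fromℚ 0ℚ
n@(suc m) ^ x = record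
  { _∋_       = λ p → ∃[ q ] ∃[ s ] (p ℚ.< q × x ∋ s × q ≤[ n ^ s ])
  ; inhabited = let s , x∋s = X.inhabited in
      0ℚ ℚ.- 1ℚ , 0ℚ , s , q-1<q 0ℚ , x∋s , inj₁ ℚ.≤-refl
  ; bounded   = let t , x∌t = X.bounded
                    B = suc ℤ.∣ ↥ t ∣ in
      fromℕ n ^ℚ B , λ (q , s , p<q , x∋s , q≤) →
        ℚ.<-irrefl refl (ℚ.<-≤-trans p<q
          (power-bound m B (ℚ.<-trans (s<t x∌t x∋s) (q<bound t)) q≤))
  ; lower     = λ p<p′ (q , s , p′<q , rest) → q , s , ℚ.<-trans p<p′ p′<q , rest
  ; rounded   = λ (q , s , p<q , rest) → let p′ , p<p′ , p′<q = ℚ.<-dense p<q in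
      p′ , p<p′ , q , s , p′<q , rest
  }
  where
  module X = ℝ x
  s<t : ∀ {s t} → ¬ x ∋ t → x ∋ s → s ℚ.< t
  s<t {s} {t} x∌t x∋s with ℚ.<-cmp s t
  ... | tri< s<t _ _  = s<t
  ... | tri≈ _ refl _ = ⊥-elim (x∌t x∋s)
  ... | tri> _ _ t<s  = ⊥-elim (x∌t (X.lower t<s x∋s))

Limit : (ℕ → ℝ) → ℝ → Set
Limit a x = ∀ ε → 0ℚ ℚ.< ε →
  ∃[ N ] ∀ k → N ℕ.≤ k → a k ≤ x + ε × x ≤ a k + ε

IsInfimum : ∀ {ℓ} → (ℝ → Set ℓ) → ℝ → Set (Level.suc 0ℓ ⊔ ℓ)
IsInfimum S x = (∀ y → S y → x ≤ y) × (∀ z → (∀ y → S y → z ≤ y) → z ≤ x)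

record Graph (d : ℕ) : Set₁ where
  field
    Adj    : Rel (Fin d) 0ℓ
    adj?   : Decidable Adj
    symm   : Symmetric Adj
    irrefl : Irreflexive _≡_ Adj

  -- The edge {u , v} is listed once, as the pair with u < v.
  edges : List (Fin d × Fin d)
  edges = List.filter (λ (u , v) → (u Fin.<? v) ×-dec adj? u v)
            (List.cartesianProduct (List.allFin d) (List.allFin d))

  size : ℕ
  size = List.length edges

  -- The edges incident to a vertex, as indices into the list of edges.
  I : Fin d → List (Fin size)
  I v = List.filter
    (λ e → (v Fin.≟ proj₁ (List.lookup edges e)) ⊎-dec (v Fin.≟ proj₂ (List.lookup edges e)))
    (List.allFin size)

K : (d : ℕ) → Graph d
K d = record
  { Adj    = _≢_
  ; adj?   = λ u v → ¬? (u Fin.≟ v)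
  ; symm   = ≢-sym
  ; irrefl = λ u≡v u≢v → u≢v u≡v
  }

Modes : ℕ → Set₁
Modes d = Fin d → Set

_⊠_ : ∀ {d} → Modes d → Modes d → Modes d
(X ⊠ Y) i = X i × Y i

_^⊠_ : ∀ {d} → Modes d → ℕ → Modes d
X ^⊠ zero  = λ _ → ⊤
X ^⊠ suc k = X ⊠ (X ^⊠ k)

module Tensors {c ℓ₁ ℓ₂} (F : HeytingField c ℓ₁ ℓ₂) where

  open HeytingField F
    using (Carrier; _≈_; _*_; 0#; 1#; heytingCommutativeRing; *-cong)
  private
    module F = CommutativeRing (HeytingCommutativeRing.commutativeRing heytingCommutativeRing)
    module Sum = RawSemiring (Semiring.rawSemiring F.semiring) using (sum; product)
    import Algebra.Properties.Monoid.Sum F.+-monoid as +-Sum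
    import Algebra.Properties.Monoid.Sum F.*-monoid as *-Sum

  -- A tensor is given by its coefficients: coeff x is the coefficient of the
  -- monomial with the variable x i from the i-th mode.
  record Tensor {d} (X : Modes d) : Set (c ⊔ ℓ₁) where
    field
      coeff      : (∀ i → X i) → Carrier
      coeff-cong : ∀ {x y} → (∀ i → x i ≡ y i) → coeff x ≈ coeff y

  open Tensor public

  infix 4 _≋_
  _≋_ : ∀ {d} {X : Modes d} → Tensor X → Tensor X → Set ℓ₁
  S ≋ T = ∀ x → coeff S x ≈ coeff T x

  ∑ : ∀ {d r} {X : Modes d} → (Fin r → Tensor X) → Tensor X
  ∑ T = record
    { coeff      = λ x → Sum.sum (λ t → coeff (T t) x)
    ; coeff-cong = λ x≡y → +-Sum.sum-cong-≋ (λ t → coeff-cong (T t) x≡y)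
    }

  LinearForm : Set → Set c
  LinearForm A = A → Carrier

  ∏ : ∀ {d} {X : Modes d} → (∀ j → LinearForm (X j)) → Tensor X
  ∏ l = record
    { coeff      = λ x → Sum.product (λ j → l j (x j))
    ; coeff-cong = λ x≡y → *-Sum.sum-cong-≋ (λ j → F.reflexive (cong (l j) (x≡y j)))
    }

  var : ∀ {A} → DecidableEquality A → A → LinearForm A
  var _≟_ a b = if does (a ≟ b) then 1# else 0#

  infixr 7 _⊗_
  infixl 8 _^⊗_

  _⊗_ : ∀ {d} {X Y : Modes d} → Tensor X → Tensor Y → Tensor (X ⊠ Y)
  S ⊗ T = record
    { coeff      = λ z → coeff S (λ i → proj₁ (z i)) * coeff T (λ i → proj₂ (z i))
    ; coeff-cong = λ z≡w → *-cong
        (coeff-cong S (λ i → cong proj₁ (z≡w i)))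
        (coeff-cong T (λ i → cong proj₂ (z≡w i)))
    }

  _^⊗_ : ∀ {d} {X : Modes d} → Tensor X → (k : ℕ) → Tensor (X ^⊠ k)
  T ^⊗ zero  = record { coeff = λ _ → 1# ; coeff-cong = λ _ → F.refl }
  T ^⊗ suc k = T ⊗ T ^⊗ k

  HasDecomposition : ∀ {d} {X : Modes d} → Tensor X → ℕ → Set (c ⊔ ℓ₁)
  HasDecomposition {X = X} T r =
    Σ (Fin r → ∀ j → LinearForm (X j)) λ l → T ≋ ∑ (λ t → ∏ (l t))

  IsRank : ∀ {d} {X : Modes d} → Tensor X → ℕ → Set (c ⊔ ℓ₁)
  IsRank T r = HasDecomposition T r × (∀ s → HasDecomposition T s → r ℕ.≤ s)

  -- The k-th term of the sequence is the (k + 1)-st root for the power k + 1.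
  IsAsymptoticRank : ∀ {d} {X : Modes d} → Tensor X → ℝ → Set (c ⊔ ℓ₁)
  IsAsymptoticRank T ρ = Σ (ℕ → ℕ) λ R →
    (∀ k → IsRank (T ^⊗ k) (R k)) ×
    Limit (λ k → R (suc k) ^ fromℚ (+ 1 ℚ./ suc k)) ρ

  module _ {d} (G : Graph d) where
    open Graph G

    -- g : I(v) → [n] is encoded by the vector of its values along the list I v.
    GraphModes : ℕ → Modes d
    GraphModes n v = Vec (Fin n) (List.length (I v))

    restrict : ∀ {n} → (Fin size → Fin n) → ∀ v → GraphModes n v
    restrict f v = Vec.map f (Vec.fromList (I v))

    -- finToFun enumerates the functions Fin size → Fin n without repetition.
    graphTensor : (n : ℕ) → Tensor (GraphModes n)
    graphTensor n = ∑ {r = n ℕ.^ size} λ t →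
      ∏ λ v → var (Vec.≡-dec Fin._≟_) (restrict (finToFun t) v)

    -- R(T_{G,n}) = O(n ^ β)
    RankBound : ℝ → Set (c ⊔ ℓ₁)
    RankBound β = ∃[ C ] ∃[ N ] ∀ n → N ℕ.≤ n → ∃[ r ]
      (IsRank (graphTensor n) r × fromℚ (fromℕ r) ≤ C · (n ^ β))

    Isω : ℝ → Set (Level.suc 0ℓ ⊔ c ⊔ ℓ₁)
    Isω = IsInfimum RankBound

    Isτ : ℝ → Set (Level.suc 0ℓ ⊔ c ⊔ ℓ₁)
    Isτ τ = ∃[ ω ] (Isω ω × τ ≃ ω / size)

{-# OPTIONS --safe #-}

-- A tensor S with modes of size M is a restriction of the graph tensor of the
-- star centred at any vertex v, with edge labels in [M]: the labels at the
-- leaves are the variables of the other modes, and the centre, which sees all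
-- the labels, reads off the coefficients of S.  Every edge of K_d lies in
-- exactly two of the d stars, so the d-th power of S is a restriction of
-- T_{K_d, M²}.  With S the k-th power of T this gives R(T^{dk}) ≤ R(T_{K_d, n^{2k}}),
-- hence ρ^{d/2} ≤ n ^ ω(K_d), and ω(K_d) = τ(d) d(d-1)/2.  The reals are lower
-- cuts, so the last step compares rational powers: if ρ exceeds n ^ s, every β
-- with R(T_{K_d, N}) = O(N ^ β) exceeds sd/2.

module Submission where

open import Defs
open import Algebra.Apartness.Bundles using (HeytingField; HeytingCommutativeRing)
open import Algebra.Bundles using (CommutativeRing; CommutativeSemiring)
import Algebra.Properties.CommutativeMonoid.Sum as CommutativeMonoidSum
import Algebra.Properties.CommutativeSemiring.Exp as Exp
import Algebra.Properties.Semiring.Sum as SemiringSum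
open import Data.Bool.Base using (if_then_else_)
open import Data.Fin.Base as Fin using (Fin; zero; suc; finToFun; funToFin)
import Data.Fin.Properties as Fin
open import Data.Integer.Base as ℤ using (+_; -[1+_])
import Data.Integer.Properties as ℤ
open import Data.List.Base as List using (List)
open import Data.List.Membership.Propositional.Properties
  using (∈-filter⁺; ∈-filter⁻; ∈-cartesianProduct⁺; ∈-allFin; ∈-lookup)
import Data.List.Properties as List
import Data.List.Relation.Unary.Any as Any
import Data.List.Relation.Unary.Any.Properties as Any
open import Data.Nat.Base as ℕ using (ℕ; zero; suc; _∸_)
open import Data.Nat.ListAction using () renaming (sum to sumℕ)
import Data.Nat.Properties as ℕ
open import Data.Product.Base using (∃-syntax; _×_; _,_; proj₁; proj₂; uncurry)
open import Data.Rational.Base as ℚ using (ℚ; mkℚ; ↥_; ↧ₙ_; 0ℚ; 1ℚ)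
import Data.Rational.Properties as ℚ
open import Data.Rational.Solver using () renaming (module +-*-Solver to ℚ-Solver)
import Data.Rational.Unnormalised.Base as ℚᵘ
open import Data.Rational.Unnormalised.Base using (mkℚᵘ; *≡*; *≤*)
import Data.Rational.Unnormalised.Properties as ℚᵘ
open import Data.Sum.Base using (_⊎_; inj₁; inj₂)
open import Data.Unit.Base using (tt)
open import Data.Vec.Base as Vec using (Vec)
import Data.Vec.Properties as Vec
open import Function.Base using (_∘_)
open import Relation.Binary.Definitions using (DecidableEquality)
import Relation.Binary.PropositionalEquality as ≡
open ≡ using (_≡_; _≢_)
open import Relation.Nullary using (¬_; Dec; yes; no; contradiction)
open import Relation.Nullary.Decidable using (does; ¬?; _×-dec_; _⊎-dec_)

open Exp (CommutativeRing.commutativeSemiring ℚ.+-*-commutativeRing)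
  using (^-homo-*; ^-assocʳ; ^-distrib-*)

-- A vertex is a leaf in `d - 1` stars and the centre of one, yet its mode admits only one linear
-- substitution, which has to serve all these roles. As a leaf it only vetoes: its coefficient
-- vanishes on labellings that disagree with its variable. As the centre it contributes a
-- coefficient of `S`. Each of the two labels on an edge is checked by exactly one end, so the
-- vetoes of all vertices together leave a single labelling, and on that one every centre reads the
-- right labels.
--
-- On the analytic side, the constant in `O(N ^ β)` is paid for by a gap between bases: if `c < q₂`,
-- then `C c^(dk) < q₂^(dk)` for large `k`. Each passage between a real and a rational power also
-- costs a strict inequality, whence the chain `q < a < b < c < q₂ < q₁` of rationals. Exponents can
-- be recovered from powers of `n` only when `n ≥ 2`; for `n = 1` the graph tensor is a single
-- product, which bounds `ρ` directly.

-- Finite sums and linear substitutions in sums of products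

module FiniteSums {c ℓ} (R : CommutativeSemiring c ℓ) where

  open CommutativeSemiring R hiding (zero)
  open SemiringSum semiring
  open CommutativeMonoidSum *-commutativeMonoid using ()
    renaming (sum to product)
  open import Relation.Binary.Reasoning.Setoid setoid

  sum-zero : ∀ {r} {f : Fin r → Carrier} → (∀ t → f t ≈ 0#) → sum f ≈ 0#
  sum-zero {r} f≈0 = trans (sum-cong-≋ f≈0) (sum-replicate-zero r)

  sum-single : ∀ {r} {f : Fin r → Carrier} t₀ → (∀ t → t ≢ t₀ → f t ≈ 0#) →
               sum f ≈ f t₀
  sum-single zero f≈0 =
    trans (+-congˡ (sum-zero λ t → f≈0 (suc t) λ ())) (+-identityʳ _)
  sum-single (suc t₀) f≈0 =
    trans (+-cong (f≈0 zero λ ())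
                  (sum-single t₀ λ t t≢t₀ → f≈0 (suc t) (t≢t₀ ∘ Fin.suc-injective)))
          (+-identityˡ _)

  product-zero : ∀ {r} {f : Fin r → Carrier} t → f t ≈ 0# → product f ≈ 0#
  product-zero zero    f≈0 = trans (*-congʳ f≈0) (zeroˡ _)
  product-zero (suc t) f≈0 = trans (*-congˡ (product-zero t f≈0)) (zeroʳ _)

  -- The image of the linear form `p` when each variable `a` is replaced by the value `φ a`.
  ⟪_∣_∣_⟫ : ∀ {a} {A : Set a} {m} → (Fin m → A) → (A → Carrier) → (A → Carrier) → Carrier
  ⟪ en ∣ p ∣ φ ⟫ = sum λ i → p (en i) * φ (en i)

  ∑-cong : ∀ n {f g : Fin n → Carrier} → (∀ i → f i ≈ g i) → sum f ≈ sum g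
  ∑-cong n = sum-cong-≋ {n}

  sum-interchange : ∀ {a m} (w P : Fin a → Carrier) (q : Fin a → Fin m → Carrier) (c : Fin m → Carrier) →
    sum (λ t → w t * (sum (λ i → q t i * c i) * P t)) ≈
    sum (λ i → c i * sum (λ t → (w t * q t i) * P t))
  sum-interchange {a} {m} w P q c = begin
    sum (λ t → w t * (sum (λ i → q t i * c i) * P t))   ≈⟨ ∑-cong a inner ⟩
    sum (λ t → sum (λ i → c i * ((w t * q t i) * P t)))
      ≈⟨ ∑-comm {a} {m} (λ t i → c i * ((w t * q t i) * P t)) ⟩
    sum (λ i → sum (λ t → c i * ((w t * q t i) * P t)))
      ≈⟨ ∑-cong m (λ i → *-distribˡ-sum (c i) λ t → (w t * q t i) * P t) ⟨
    sum (λ i → c i * sum (λ t → (w t * q t i) * P t))   ∎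
    where
    rotate : ∀ w q c P → w * ((q * c) * P) ≈ c * ((w * q) * P)
    rotate w q c P = begin
      w * ((q * c) * P) ≈⟨ *-assoc _ _ _ ⟨
      (w * (q * c)) * P ≈⟨ *-congʳ (*-assoc _ _ _) ⟨
      ((w * q) * c) * P ≈⟨ *-congʳ (*-comm _ _) ⟩
      (c * (w * q)) * P ≈⟨ *-assoc _ _ _ ⟩
      c * ((w * q) * P) ∎
    inner : ∀ t → w t * (sum (λ i → q t i * c i) * P t) ≈ sum (λ i → c i * ((w t * q t i) * P t))
    inner t = begin
      w t * (sum (λ i → q t i * c i) * P t)     ≈⟨ *-congˡ (*-distribʳ-sum (P t) λ i → q t i * c i) ⟩
      w t * sum (λ i → (q t i * c i) * P t)     ≈⟨ *-distribˡ-sum (w t) (λ i → (q t i * c i) * P t) ⟩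
      sum (λ i → w t * ((q t i * c i) * P t))   ≈⟨ ∑-cong m (λ i → rotate (w t) (q t i) (c i) (P t)) ⟩
      sum (λ i → c i * ((w t * q t i) * P t))   ∎

  -- An identity between sums of products survives a linear substitution in every mode. The
  -- induction treats one mode at a time: with its variable fixed at `x₀`, the factor of that mode
  -- is a scalar. The weights `w` and `w′` are there to collect these scalars.
  contract-cong : ∀ {d a b x} {X : Fin d → Set x} {m : Fin d → ℕ}
    (en : ∀ v → Fin (m v) → X v) (φ : ∀ v → X v → Carrier)
    (w : Fin a → Carrier) (p : Fin a → ∀ v → X v → Carrier)
    (w′ : Fin b → Carrier) (l : Fin b → ∀ v → X v → Carrier) →
    (∀ (x : ∀ v → X v) → sum (λ t → w t * product (λ v → p t v (x v))) ≈
                         sum (λ t → w′ t * product (λ v → l t v (x v)))) →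
    sum (λ t → w t * product (λ v → ⟪ en v ∣ p t v ∣ φ v ⟫)) ≈
    sum (λ t → w′ t * product (λ v → ⟪ en v ∣ l t v ∣ φ v ⟫))
  contract-cong {zero} en φ w p w′ l h = h λ ()
  contract-cong {suc d} {a} {b} {X = X} {m} en φ w p w′ l h = begin
    sum (λ t → w t * (⟪ en zero ∣ p t zero ∣ φ zero ⟫ * P t))
      ≈⟨ sum-interchange w P (λ t i → p t zero (en zero i)) (φ zero ∘ en zero) ⟩
    sum (λ i → φ zero (en zero i) * sum (λ t → (w t * p t zero (en zero i)) * P t))
      ≈⟨ ∑-cong (m zero) (λ i → *-congˡ (rec (en zero i))) ⟩
    sum (λ i → φ zero (en zero i) * sum (λ t → (w′ t * l t zero (en zero i)) * L t))
      ≈⟨ sum-interchange w′ L (λ t i → l t zero (en zero i)) (φ zero ∘ en zero) ⟨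
    sum (λ t → w′ t * (⟪ en zero ∣ l t zero ∣ φ zero ⟫ * L t)) ∎
    where
    P = λ t → product (λ v → ⟪ en (suc v) ∣ p t (suc v) ∣ φ (suc v) ⟫)
    L = λ t → product (λ v → ⟪ en (suc v) ∣ l t (suc v) ∣ φ (suc v) ⟫)
    cons : X zero → (∀ v → X (suc v)) → ∀ v → X v
    cons x₀ x zero    = x₀
    cons x₀ x (suc v) = x v
    rec : ∀ x₀ → sum (λ t → (w t * p t zero x₀) * P t) ≈ sum (λ t → (w′ t * l t zero x₀) * L t)
    rec x₀ = contract-cong {d} (λ v → en (suc v)) (λ v → φ (suc v))
      (λ t → w t * p t zero x₀) (λ t v → p t (suc v)) (λ t → w′ t * l t zero x₀) (λ t v → l t (suc v)) λ x →
      trans (∑-cong a (λ t → *-assoc _ _ _))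
        (trans (h (cons x₀ x)) (∑-cong b (λ t → sym (*-assoc _ _ _))))

-- Edges and stars of the complete graph

module CompleteGraph (d : ℕ) where

  open Graph (K d) public

  ends : Fin size → Fin d × Fin d
  ends = List.lookup edges

  Incident : Fin d → Fin size → Set
  Incident v e = v ≡ proj₁ (ends e) ⊎ v ≡ proj₂ (ends e)

  ends-< : ∀ e → proj₁ (ends e) Fin.< proj₂ (ends e)
  ends-< e = proj₁ (proj₂ (∈-filter⁻ (λ (u , v) → (u Fin.<? v) ×-dec ¬? (u Fin.≟ v))
    {xs = List.cartesianProduct (List.allFin d) (List.allFin d)} (∈-lookup {xs = edges} e)))

  ordered-edge : ∀ {u v} → u Fin.< v → ∃[ e ] ends e ≡ (u , v)
  ordered-edge {u} {v} u<v = Any.index uv∈edges , ≡.sym (Any.lookup-index uv∈edges)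
    where
    uv∈edges = ∈-filter⁺ (λ (u , v) → (u Fin.<? v) ×-dec ¬? (u Fin.≟ v))
      (∈-cartesianProduct⁺ (∈-allFin u) (∈-allFin v)) (u<v , Fin.<⇒≢ u<v)

  position : ∀ {v e} → Incident v e → ∃[ p ] List.lookup (I v) p ≡ e
  position {v} {e} v∈e = Any.index e∈I , ≡.sym (Any.lookup-index e∈I)
    where
    e∈I = ∈-filter⁺ (λ e → (v Fin.≟ proj₁ (ends e)) ⊎-dec (v Fin.≟ proj₂ (ends e))) (∈-allFin e) v∈e

  incident : ∀ v p → Incident v (List.lookup (I v) p)
  incident v p = proj₂ (∈-filter⁻ (λ e → (v Fin.≟ proj₁ (ends e)) ⊎-dec (v Fin.≟ proj₂ (ends e)))
    {xs = List.allFin size} (∈-lookup {xs = I v} p))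

  -- The other end of `e`, provided that `v` is an end of it.
  far : Fin d → Fin size → Fin d
  far v e = if does (v Fin.≟ proj₁ (ends e)) then proj₂ (ends e) else proj₁ (ends e)

  edge : ∀ {u v} → u ≢ v → ∃[ e ] Incident v e × far v e ≡ u
  edge {u} {v} u≢v with ℕ.≤-total (Fin.toℕ u) (Fin.toℕ v)
  ... | inj₁ u≤v with e , eq ← ordered-edge (Fin.≤∧≢⇒< u≤v u≢v) = e , inj₂ (≡.sym (≡.cong proj₂ eq)) , far≡
    where
    far≡ : far v e ≡ u
    far≡ with v Fin.≟ proj₁ (ends e)
    ... | yes v≡ = contradiction (≡.sym (≡.trans v≡ (≡.cong proj₁ eq))) u≢v
    ... | no _   = ≡.cong proj₁ eq
  ... | inj₂ v≤u with e , eq ← ordered-edge (Fin.≤∧≢⇒< v≤u (u≢v ∘ ≡.sym)) = e , inj₁ (≡.sym (≡.cong proj₁ eq)) , far≡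
    where
    far≡ : far v e ≡ u
    far≡ with v Fin.≟ proj₁ (ends e)
    ... | yes _ = ≡.cong proj₂ eq
    ... | no v≢ = contradiction (≡.sym (≡.cong proj₁ eq)) v≢

  -- An edge {a , b} with a < b carries a pair of labels: the first one belongs
  -- to the star centred at a, with leaf b, and the second one to the star
  -- centred at b, with leaf a.
  module _ {A : Set} where

    leaf centre : Fin d → Fin size → A × A → A
    leaf   v e (s , t) = if does (v Fin.≟ proj₁ (ends e)) then t else s
    centre v e (s , t) = if does (v Fin.≟ proj₁ (ends e)) then s else t

    -- Here `y v u` is the variable of mode `v` in the `u`-th factor of the power, the factor that
    -- belongs to the star centred at `u`.
    labels : (Fin d → Fin d → A) → Fin size → A × A
    labels y e = let a , b = ends e in y b a , y a b

    leaf-labels : ∀ y {v e} → Incident v e → leaf v e (labels y e) ≡ y v (far v e)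
    leaf-labels y {v} {e} inc with v Fin.≟ proj₁ (ends e)
    leaf-labels y inc         | yes ≡.refl = ≡.refl
    leaf-labels y (inj₁ v≡)   | no v≢      = contradiction v≡ v≢
    leaf-labels y (inj₂ ≡.refl) | no _     = ≡.refl

    centre-labels : ∀ y {v e} → Incident v e → centre v e (labels y e) ≡ y (far v e) v
    centre-labels y {v} {e} inc with v Fin.≟ proj₁ (ends e)
    centre-labels y inc         | yes ≡.refl = ≡.refl
    centre-labels y (inj₁ v≡)   | no v≢      = contradiction v≡ v≢
    centre-labels y (inj₂ ≡.refl) | no _     = ≡.refl

    -- The two ends of an edge are leaves of different stars, so each fixes one component of the
    -- pair.
    labels-unique : ∀ y {e w} → (∀ v → Incident v e → leaf v e w ≡ y v (far v e)) → w ≡ labels y e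
    labels-unique y {e} {w} h = ≡.cong₂ _,_ first second
      where
      a = proj₁ (ends e)
      b = proj₂ (ends e)
      first : proj₁ w ≡ y b a
      first with h b (inj₂ ≡.refl)
      ... | hb with b Fin.≟ a
      ...   | yes b≡a = contradiction (≡.sym b≡a) (Fin.<⇒≢ (ends-< e))
      ...   | no _    = hb
      second : proj₂ w ≡ y a b
      second with h a (inj₁ ≡.refl)
      ... | ha with a Fin.≟ a
      ...   | yes _  = ha
      ...   | no a≢a = contradiction ≡.refl a≢a

-- The number of edges of the complete graph

count : ∀ {A : Set} {P : A → Set} → (∀ x → Dec (P x)) → List A → ℕ
count P? xs = List.length (List.filter P? xs)

count-map : ∀ {A B : Set} {P : B → Set} {Q : A → Set} (P? : ∀ x → Dec (P x)) (Q? : ∀ x → Dec (Q x))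
  (f : A → B) → (∀ x → P (f x) → Q x) → (∀ x → Q x → P (f x)) →
  ∀ xs → count P? (List.map f xs) ≡ count Q? xs
count-map P? Q? f P⇒Q Q⇒P List.[] = ≡.refl
count-map P? Q? f P⇒Q Q⇒P (x List.∷ xs) with P? (f x) | Q? x
... | yes p | yes q = ≡.cong suc (count-map P? Q? f P⇒Q Q⇒P xs)
... | yes p | no ¬q = contradiction (P⇒Q x p) ¬q
... | no ¬p | yes q = contradiction (Q⇒P x q) ¬p
... | no ¬p | no ¬q = count-map P? Q? f P⇒Q Q⇒P xs

count-cartesianProduct : ∀ {A B : Set} {P : A × B → Set} (P? : ∀ x → Dec (P x)) xs ys →
  count P? (List.cartesianProduct xs ys) ≡ sumℕ (List.map (λ x → count (λ y → P? (x , y)) ys) xs)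
count-cartesianProduct P? List.[] ys = ≡.refl
count-cartesianProduct P? (x List.∷ xs) ys = begin
  count P? (List.map (x ,_) ys List.++ List.cartesianProduct xs ys)
    ≡⟨ ≡.cong List.length (List.filter-++ P? (List.map (x ,_) ys) _) ⟩
  List.length (List.filter P? (List.map (x ,_) ys) List.++ List.filter P? (List.cartesianProduct xs ys))
    ≡⟨ List.length-++ (List.filter P? (List.map (x ,_) ys)) ⟩
  count P? (List.map (x ,_) ys) ℕ.+ count P? (List.cartesianProduct xs ys)
    ≡⟨ ≡.cong₂ ℕ._+_ (count-map P? (λ y → P? (x , y)) (x ,_) (λ _ p → p) (λ _ p → p) ys)
                     (count-cartesianProduct P? xs ys) ⟩
  sumℕ (List.map (λ x → count (λ y → P? (x , y)) ys) (x List.∷ xs)) ∎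
  where open ≡.≡-Reasoning

count-all : ∀ {A : Set} {P : A → Set} (P? : ∀ x → Dec (P x)) → (∀ x → P x) → ∀ xs → count P? xs ≡ List.length xs
count-all P? p List.[] = ≡.refl
count-all P? p (x List.∷ xs) with P? x
... | yes _ = ≡.cong suc (count-all P? p xs)
... | no ¬p = contradiction (p x) ¬p

allFin-suc : ∀ d → List.allFin (suc d) ≡ zero List.∷ List.map suc (List.allFin d)
allFin-suc d = ≡.cong (zero List.∷_) (≡.sym (List.map-tabulate (λ i → i) suc))

_<?≢_ : ∀ {d} (u v : Fin d) → Dec (u Fin.< v × u ≢ v)
u <?≢ v = (u Fin.<? v) ×-dec ¬? (u Fin.≟ v)

row-zero : ∀ d → count (zero {d} <?≢_) (List.allFin (suc d)) ≡ d
row-zero d = ≡.trans (≡.cong (count (zero {d} <?≢_)) (allFin-suc d))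
  (≡.trans (≡.trans
    (count-map (zero {d} <?≢_) (λ _ → yes tt) suc (λ _ _ → tt) (λ _ _ → ℕ.s≤s ℕ.z≤n , λ ()) (List.allFin d))
    (count-all (λ _ → yes tt) (λ _ → tt) (List.allFin d)))
    (List.length-tabulate (λ i → i)))

row-suc : ∀ {d} (u : Fin d) → count (suc u <?≢_) (List.allFin (suc d)) ≡ count (u <?≢_) (List.allFin d)
row-suc {d} u = ≡.trans (≡.cong (count (suc u <?≢_)) (allFin-suc d))
  (count-map (suc u <?≢_) (u <?≢_) suc
    (λ { v (ℕ.s≤s u<v , u≢v) → u<v , u≢v ∘ ≡.cong suc })
    (λ { v (u<v , u≢v) → ℕ.s≤s u<v , u≢v ∘ Fin.suc-injective }) (List.allFin d))

size-rows : ∀ d → Graph.size (K d) ≡ sumℕ (List.map (λ u → count (u <?≢_) (List.allFin d)) (List.allFin d))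
size-rows d = count-cartesianProduct (uncurry _<?≢_) (List.allFin d) (List.allFin d)

-- Vertex `zero` precedes the `d` others, and the pairs among these form a shifted copy of the edges
-- of `K d`.
size-suc : ∀ d → Graph.size (K (suc d)) ≡ d ℕ.+ Graph.size (K d)
size-suc d = begin
  Graph.size (K (suc d))                                ≡⟨ size-rows (suc d) ⟩
  sumℕ (List.map row′ (List.allFin (suc d)))        ≡⟨ ≡.cong (sumℕ ∘ List.map row′) (allFin-suc d) ⟩
  row′ zero ℕ.+ sumℕ (List.map row′ (List.map suc (List.allFin d)))
    ≡⟨ ≡.cong₂ ℕ._+_ (row-zero d)
         (≡.cong sumℕ (≡.trans (≡.sym (List.map-∘ (List.allFin d))) (List.map-cong row-suc (List.allFin d)))) ⟩
  d ℕ.+ sumℕ (List.map (λ u → count (u <?≢_) (List.allFin d)) (List.allFin d))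
    ≡⟨ ≡.cong (d ℕ.+_) (size-rows d) ⟨
  d ℕ.+ Graph.size (K d)                                ∎
  where
  open ≡.≡-Reasoning
  row′ : Fin (suc d) → ℕ
  row′ u = count (u <?≢_) (List.allFin (suc d))

2*size : ∀ d → 2 ℕ.* Graph.size (K d) ≡ d ℕ.* (d ∸ 1)
2*size zero          = ≡.refl
2*size (suc zero)    = ≡.refl
2*size (suc (suc d)) = begin
  2 ℕ.* Graph.size (K (suc (suc d)))           ≡⟨ ≡.cong (2 ℕ.*_) (size-suc (suc d)) ⟩
  2 ℕ.* (suc d ℕ.+ Graph.size (K (suc d)))     ≡⟨ ℕ.*-distribˡ-+ 2 (suc d) _ ⟩
  2 ℕ.* suc d ℕ.+ 2 ℕ.* Graph.size (K (suc d)) ≡⟨ ≡.cong (2 ℕ.* suc d ℕ.+_) (2*size (suc d)) ⟩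
  2 ℕ.* suc d ℕ.+ suc d ℕ.* d                  ≡⟨ ≡.cong (2 ℕ.* suc d ℕ.+_) (ℕ.*-comm (suc d) d) ⟩
  2 ℕ.* suc d ℕ.+ d ℕ.* suc d                  ≡⟨ ℕ.*-distribʳ-+ (suc d) 2 d ⟨
  suc (suc d) ℕ.* suc d                        ∎
  where open ≡.≡-Reasoning

-- Kronecker powers: finite indexing of modes and division into blocks

encode : ∀ {d n} k {v : Fin d} → ((λ _ → Fin n) ^⊠ k) v → Fin (n ℕ.^ k)
encode zero    _        = zero
encode (suc k) (x , xs) = Fin.combine x (encode k xs)

decode : ∀ {d n} k {v : Fin d} → Fin (n ℕ.^ k) → ((λ _ → Fin n) ^⊠ k) v
decode     zero    _ = tt
decode {n = n} (suc k) i = Fin.quotient (n ℕ.^ k) i , decode k (Fin.remainder {n} (n ℕ.^ k) i)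

decode-encode : ∀ {d n} k {v : Fin d} (x : ((λ _ → Fin n) ^⊠ k) v) → x ≡ decode k (encode k x)
decode-encode zero    _        = ≡.refl
decode-encode {n = n} (suc k) {v} (x , xs) = ≡.sym (≡.cong₂ _,_ (≡.cong proj₁ eq)
  (≡.trans (≡.cong (decode k {v} ∘ proj₂) eq) (≡.sym (decode-encode k xs))))
  where eq = Fin.remQuot-combine x (encode k {v} xs)

module _ {d} {X : Modes d} where

  takeₘ : ∀ k m {v} → (X ^⊠ (k ℕ.+ m)) v → (X ^⊠ k) v
  takeₘ zero    m _        = tt
  takeₘ (suc k) m (x , xs) = x , takeₘ k m xs

  dropₘ : ∀ k m {v} → (X ^⊠ (k ℕ.+ m)) v → (X ^⊠ m) v
  dropₘ zero    m xs       = xs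
  dropₘ (suc k) m (x , xs) = dropₘ k m xs

  block : ∀ b k {v} → (X ^⊠ (b ℕ.* k)) v → Fin b → (X ^⊠ k) v
  block (suc b) k xs zero    = takeₘ k (b ℕ.* k) xs
  block (suc b) k xs (suc u) = block b k (dropₘ k (b ℕ.* k) xs) u

lookup-map-fromList : ∀ {A B : Set} (f : A → B) (xs : List A) i →
  Vec.lookup (Vec.map f (Vec.fromList xs)) i ≡ f (List.lookup xs i)
lookup-map-fromList f (x List.∷ xs) zero    = ≡.refl
lookup-map-fromList f (x List.∷ xs) (suc i) = lookup-map-fromList f xs i

-- Restrictions of graph tensors and the power of stars

module Restrictions {c ℓ₁ ℓ₂} (F : HeytingField c ℓ₁ ℓ₂) where

  open Tensors F
  private
    CR = HeytingCommutativeRing.commutativeRing (HeytingField.heytingCommutativeRing F)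
  open CommutativeRing CR
    using (Carrier; _≈_; _*_; 0#; 1#; semiring; commutativeSemiring; *-commutativeMonoid;
           trans; sym; refl; *-identityˡ; zeroˡ; *-congˡ; *-assoc; setoid)
  open SemiringSum semiring
  open CommutativeMonoidSum *-commutativeMonoid using ()
    renaming (sum to product; sum-cong-≋ to product-cong-≋)
  open FiniteSums commutativeSemiring
  open import Relation.Binary.Reasoning.Setoid setoid

  guard : ∀ {P : Set} → Dec P → Carrier → Carrier
  guard (yes _) x = x
  guard (no _)  x = 0#

  guard-true : ∀ {P : Set} {x} → P → (P? : Dec P) → guard P? x ≈ x
  guard-true p (yes _) = refl
  guard-true p (no ¬p) = contradiction p ¬p

  guard-false : ∀ {P : Set} {x} → ¬ P → (P? : Dec P) → guard P? x ≈ 0#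
  guard-false ¬p (yes p) = contradiction p ¬p
  guard-false ¬p (no _)  = refl

  pair-var : ∀ {A m} (_≟_ : DecidableEquality A) (en : Fin m → A) (φ : A → Carrier) (a : A) i₀ →
             en i₀ ≡ a → (∀ i → a ≡ en i → i ≡ i₀) → ⟪ en ∣ var _≟_ a ∣ φ ⟫ ≈ φ a
  pair-var _≟_ en φ a i₀ ei₀ unique = trans (sum-single i₀ off) on
    where
    off : ∀ i → i ≢ i₀ → var _≟_ a (en i) * φ (en i) ≈ 0#
    off i i≢i₀ with a ≟ en i
    ... | yes a≡eni = contradiction (unique i a≡eni) i≢i₀
    ... | no _      = zeroˡ _
    on : var _≟_ a (en i₀) * φ (en i₀) ≈ φ a
    on rewrite ei₀ with a ≟ a
    ... | yes _  = *-identityˡ _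
    ... | no a≢a = contradiction ≡.refl a≢a

  vectors : ∀ N k → Fin (N ℕ.^ k) → Vec (Fin N) k
  vectors N k t = Vec.tabulate (finToFun {N} {k} t)

  funToFin-cong : ∀ {m n} {f g : Fin m → Fin n} → (∀ i → f i ≡ g i) → funToFin f ≡ funToFin g
  funToFin-cong {zero}  f≗g = ≡.refl
  funToFin-cong {suc m} f≗g = ≡.cong₂ Fin.combine (f≗g zero) (funToFin-cong (f≗g ∘ suc))

  finToFun-unique : ∀ {m n} (f : Fin m → Fin n) t → (∀ i → finToFun t i ≡ f i) → t ≡ funToFin f
  finToFun-unique {m} f t t≗f = ≡.trans (≡.sym (Fin.funToFin-finToFin {m} t)) (funToFin-cong t≗f)

  pair-vector : ∀ {N k} (φ : Vec (Fin N) k → Carrier) g →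
                ⟪ vectors N k ∣ var (Vec.≡-dec Fin._≟_) g ∣ φ ⟫ ≈ φ g
  pair-vector {N} {k} φ g = pair-var (Vec.≡-dec Fin._≟_) (vectors N k) φ g (funToFin (Vec.lookup g))
    (≡.trans (Vec.tabulate-cong (Fin.finToFun-funToFin (Vec.lookup g))) (Vec.tabulate∘lookup g))
    (λ t g≡ → finToFun-unique (Vec.lookup g) t λ i →
      ≡.sym (≡.trans (≡.cong (λ h → Vec.lookup h i) g≡) (Vec.lookup∘tabulate (finToFun t) i)))

  -- A substitution `φ` turns the monomial of a labelling into the product of the values of `φ` at
  -- its restrictions, and turns each product of linear forms into another such product. Restriction
  -- therefore does not increase the number of terms.
  graphTensor-contract : ∀ {d} (G : Graph d) N {r}
    (l : Fin r → ∀ v → LinearForm (GraphModes G N v)) → graphTensor G N ≋ ∑ (λ t → ∏ (l t)) →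
    (φ : ∀ v → LinearForm (GraphModes G N v)) →
    sum (λ t → product (λ v → φ v (restrict G (finToFun {N} {Graph.size G} t) v))) ≈
    sum (λ t → product (λ v → ⟪ vectors N _ ∣ l t v ∣ φ v ⟫))
  graphTensor-contract {d} G N {r} l eq φ = begin
    sum (λ t → product (λ v → φ v (f t v)))
      ≈⟨ ∑-cong m (λ t → product-cong-≋ {d} (λ v → pair-vector (φ v) (f t v))) ⟨
    sum (λ t → product (λ v → ⟪ vectors N _ ∣ δ t v ∣ φ v ⟫))
      ≈⟨ ∑-cong m (λ t → *-identityˡ _) ⟨
    sum (λ t → 1# * product (λ v → ⟪ vectors N _ ∣ δ t v ∣ φ v ⟫))
      ≈⟨ contract-cong {d} {m} {r} (λ v → vectors N _) φ (λ _ → 1#) δ (λ _ → 1#) l (λ x →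
           trans (∑-cong m (λ t → *-identityˡ _)) (trans (eq x) (∑-cong r (λ t → sym (*-identityˡ _))))) ⟩
    sum (λ t → 1# * product (λ v → ⟪ vectors N _ ∣ l t v ∣ φ v ⟫))
      ≈⟨ ∑-cong r (λ t → *-identityˡ _) ⟩
    sum (λ t → product (λ v → ⟪ vectors N _ ∣ l t v ∣ φ v ⟫)) ∎
    where
    m = N ℕ.^ Graph.size G
    f = λ t v → restrict G (finToFun {N} {Graph.size G} t) v
    δ = λ t v → var (Vec.≡-dec Fin._≟_) (f t v)

  -- The defining sum read as a decomposition; with one label it has one term, which settles the
  -- case `n = 1`.
  graphTensor-decomposition : ∀ {d} (G : Graph d) N → HasDecomposition (graphTensor G N) (N ℕ.^ Graph.size G)
  graphTensor-decomposition G N =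
    (λ t v → var (Vec.≡-dec Fin._≟_) (restrict G (finToFun {N} {Graph.size G} t) v)) , λ x → refl

  HasDecomposition-pullback : ∀ {d} {X Y : Modes d} {S : Tensor X} {T : Tensor Y} {r}
    (h : ∀ v → Y v → X v) → (∀ y → coeff T y ≈ coeff S (λ v → h v (y v))) →
    HasDecomposition S r → HasDecomposition T r
  HasDecomposition-pullback h T≈S∘h (l , eq) =
    (λ t v → l t v ∘ h v) , λ y → trans (T≈S∘h y) (eq (λ v → h v (y v)))

  module StarPower {d M : ℕ} (S : Tensor {d} (λ _ → Fin M)) where

    open CompleteGraph d

    -- The `d`-th Kronecker power of `S`, with its factors indexed by the vertices and each tuple of
    -- variables written as a function.
    starPower : Tensor {d} (λ _ → Fin d → Fin M)
    starPower = record
      { coeff      = λ y → product (λ u → coeff S (λ v → y v u))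
      ; coeff-cong = λ y≡z → product-cong-≋ {d} (λ u → coeff-cong S (λ v → ≡.cong (λ h → h u) (y≡z v)))
      }

    private
      N = M ℕ.* M

      split : Fin N → Fin M × Fin M
      split = Fin.remQuot M

      -- The veto of `v` as a leaf: at each incident edge, the label meant for `v` has to be its
      -- variable in the star of the other end.
      Matches : ∀ v → (Fin d → Fin M) → GraphModes (K d) N v → Set
      Matches v y g = ∀ p → leaf v (List.lookup (I v) p) (split (Vec.lookup g p)) ≡
                            y (far v (List.lookup (I v) p))

      matches? : ∀ v y g → Dec (Matches v y g)
      matches? v y g = Fin.all? λ p → _ Fin.≟ _

      -- The arguments of `S` in the star of `v`: the variables of the other modes come from the
      -- edges, while that of mode `v` itself is on no edge and is taken from `y`.
      centres : ∀ v → (Fin d → Fin M) → GraphModes (K d) N v → Fin d → Fin M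
      centres v y g u with u Fin.≟ v
      ... | yes _ = y v
      ... | no u≢v = let e , v∈e , _ = edge u≢v in
        centre v e (split (Vec.lookup g (proj₁ (position v∈e))))

      φ : ∀ v → (Fin d → Fin M) → LinearForm (GraphModes (K d) N v)
      φ v y g = guard (matches? v y g) (coeff S (centres v y g))

      module _ (y : Fin d → Fin d → Fin M) where

        f₀ : Fin size → Fin N
        f₀ e = uncurry Fin.combine (labels y e)

        split-f₀ : ∀ e → split (f₀ e) ≡ labels y e
        split-f₀ e = uncurry Fin.remQuot-combine (labels y e)

        lookup-restrict : ∀ f v p → Vec.lookup (restrict (K d) {N} f v) p ≡ f (List.lookup (I v) p)
        lookup-restrict f v p = lookup-map-fromList f (I v) p

        -- The hypothesis is pointwise because the enumeration of labellings returns `f₀` only up to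
        -- pointwise equality.
        f₀-matches : ∀ f → (∀ e → f e ≡ f₀ e) → ∀ v → Matches v (y v) (restrict (K d) f v)
        f₀-matches f f≗f₀ v p = ≡.trans
          (≡.cong (leaf v e) (≡.trans (≡.cong split (≡.trans (lookup-restrict f v p) (f≗f₀ e))) (split-f₀ e)))
          (leaf-labels y (incident v p))
          where e = List.lookup (I v) p

        matches-unique : ∀ f → (∀ v → Matches v (y v) (restrict (K d) f v)) → ∀ e → f e ≡ f₀ e
        matches-unique f h e = ≡.trans (≡.sym (Fin.combine-remQuot {M} M (f e)))
          (≡.cong (uncurry Fin.combine) (labels-unique y {e} {split (f e)} at))
          where
          at : ∀ v → Incident v e → leaf v e (split (f e)) ≡ y v (far v e)
          at v v∈e with p , ≡.refl ← position v∈e =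
            ≡.trans (≡.cong (leaf v _ ∘ split) (≡.sym (lookup-restrict f v p))) (h v p)

        f₀-centres : ∀ f → (∀ e → f e ≡ f₀ e) → ∀ v u → centres v (y v) (restrict (K d) f v) u ≡ y u v
        f₀-centres f f≗f₀ v u with u Fin.≟ v
        ... | yes ≡.refl = ≡.refl
        ... | no u≢v with e , v∈e , far≡u ← edge u≢v = ≡.trans
          (≡.cong (centre v e) (≡.trans (≡.cong split at) (split-f₀ e)))
          (≡.trans (centre-labels y v∈e) (≡.cong (λ u → y u v) far≡u))
          where
          p = proj₁ (position v∈e)
          at : Vec.lookup (restrict (K d) f v) p ≡ f₀ e
          at = ≡.trans (lookup-restrict f v p) (≡.trans (≡.cong f (proj₂ (position v∈e))) (f≗f₀ e))

        restricted : Fin (N ℕ.^ size) → ∀ v → GraphModes (K d) N v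
        restricted t v = restrict (K d) (finToFun {N} {size} t) v

        -- The sum over labellings collapses to the term of `f₀`, in which the factor of `v` is the
        -- coefficient of `S` in the star of `v`.
        starPower-expand : sum (λ t → product (λ v → φ v (y v) (restricted t v))) ≈ coeff starPower y
        starPower-expand = trans (sum-single t₀ off) (product-cong-≋ {d} on)
          where
          t₀ = funToFin f₀
          f≗f₀ : ∀ e → finToFun {N} {size} t₀ e ≡ f₀ e
          f≗f₀ = Fin.finToFun-funToFin f₀
          on : ∀ v → φ v (y v) (restricted t₀ v) ≈ coeff S (λ u → y u v)
          on v = trans (guard-true (f₀-matches (finToFun t₀) f≗f₀ v)
                          (matches? v (y v) (restricted t₀ v)))
                       (coeff-cong S (f₀-centres (finToFun t₀) f≗f₀ v))
          -- A labelling other than `f₀` is vetoed by some vertex; that vertex can be found since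
          -- matching is decidable and there are finitely many vertices.
          off : ∀ t → t ≢ t₀ → product (λ v → φ v (y v) (restricted t v)) ≈ 0#
          off t t≢t₀ with v , ¬m ← Fin.¬∀⟶∃¬ d _ (λ v → matches? v (y v) (restricted t v))
                (λ m → t≢t₀ (finToFun-unique f₀ t (matches-unique (finToFun t) m))) =
            product-zero v (guard-false ¬m (matches? v (y v) (restricted t v)))

    starPower-decomposition : ∀ {r} → HasDecomposition (graphTensor (K d) (M ℕ.* M)) r →
                              HasDecomposition starPower r
    starPower-decomposition (l , eq) =
      (λ t v y → ⟪ vectors N _ ∣ l t v ∣ φ v y ⟫) ,
      λ y → trans (sym (starPower-expand y)) (graphTensor-contract (K d) N l eq (λ v → φ v (y v)))

  module _ {d} {X : Modes d} (T : Tensor X) where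

    coeff-take-drop : ∀ k m y → coeff (T ^⊗ (k ℕ.+ m)) y ≈
      coeff (T ^⊗ k) (λ v → takeₘ {X = X} k m (y v)) * coeff (T ^⊗ m) (λ v → dropₘ {X = X} k m (y v))
    coeff-take-drop zero    m y = sym (*-identityˡ _)
    coeff-take-drop (suc k) m y =
      trans (*-congˡ (coeff-take-drop k m (λ v → proj₂ (y v)))) (sym (*-assoc _ _ _))

    coeff-blocks : ∀ b k y → coeff (T ^⊗ (b ℕ.* k)) y ≈
      product (λ u → coeff (T ^⊗ k) (λ v → block {X = X} b k (y v) u))
    coeff-blocks zero    k y = refl
    coeff-blocks (suc b) k y =
      trans (coeff-take-drop k (b ℕ.* k) y) (*-congˡ (coeff-blocks b k (λ v → dropₘ {X = X} k (b ℕ.* k) (y v))))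

  power-decomposition : ∀ {d n} (T : Tensor {d} (λ _ → Fin n)) k {r} →
    HasDecomposition (graphTensor (K d) (n ℕ.^ k ℕ.* n ℕ.^ k)) r → HasDecomposition (T ^⊗ (d ℕ.* k)) r
  power-decomposition {d} {n} T k hd =
    HasDecomposition-pullback {S = starPower} {T = T ^⊗ (d ℕ.* k)}
      (λ v y u → encode k {v} (block {X = λ _ → Fin n} d k y u))
      (λ y → trans (coeff-blocks T d k y) (product-cong-≋ {d} (λ u → coeff-cong (T ^⊗ k) (λ v → decode-encode k _))))
      (starPower-decomposition hd)
    where
    -- The `k`-th power of `T`, transported to modes of the form `Fin M` with `M = n ^ k`.
    S : Tensor {d} (λ _ → Fin (n ℕ.^ k))
    S = record
      { coeff      = λ x → coeff (T ^⊗ k) (λ v → decode k (x v))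
      ; coeff-cong = λ x≡y → coeff-cong (T ^⊗ k) (λ v → ≡.cong (decode k) (x≡y v))
      }
    open StarPower S

-- Arithmetic and growth of rational powers

toℚᵘ-fromℕ : ∀ n → ℚ.toℚᵘ (fromℕ n) ℚᵘ.≃ mkℚᵘ (+ n) 0
toℚᵘ-fromℕ n = ℚ.toℚᵘ-fromℚᵘ (mkℚᵘ (+ n) 0)

fromℕ-+ : ∀ m n → fromℕ (m ℕ.+ n) ≡ fromℕ m ℚ.+ fromℕ n
fromℕ-+ m n = ℚ.toℚᵘ-injective (begin
  ℚ.toℚᵘ (fromℕ (m ℕ.+ n))                    ≈⟨ toℚᵘ-fromℕ (m ℕ.+ n) ⟩
  mkℚᵘ (+ (m ℕ.+ n)) 0
    ≈⟨ *≡* (≡.cong (ℤ._* + 1) (≡.cong₂ ℤ._+_ (≡.sym (ℤ.*-identityʳ (+ m))) (≡.sym (ℤ.*-identityʳ (+ n))))) ⟩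
  mkℚᵘ (+ m) 0 ℚᵘ.+ mkℚᵘ (+ n) 0              ≈⟨ ℚᵘ.+-cong (toℚᵘ-fromℕ m) (toℚᵘ-fromℕ n) ⟨
  ℚ.toℚᵘ (fromℕ m) ℚᵘ.+ ℚ.toℚᵘ (fromℕ n)      ≈⟨ ℚ.toℚᵘ-homo-+ (fromℕ m) (fromℕ n) ⟨
  ℚ.toℚᵘ (fromℕ m ℚ.+ fromℕ n)                ∎)
  where open ℚᵘ.≃-Reasoning

fromℕ-* : ∀ m n → fromℕ (m ℕ.* n) ≡ fromℕ m ℚ.* fromℕ n
fromℕ-* m n = ℚ.toℚᵘ-injective (begin
  ℚ.toℚᵘ (fromℕ (m ℕ.* n))                    ≈⟨ toℚᵘ-fromℕ (m ℕ.* n) ⟩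
  mkℚᵘ (+ (m ℕ.* n)) 0                        ≈⟨ *≡* (≡.cong (ℤ._* + 1) (ℤ.pos-* m n)) ⟩
  mkℚᵘ (+ m) 0 ℚᵘ.* mkℚᵘ (+ n) 0              ≈⟨ ℚᵘ.*-cong (toℚᵘ-fromℕ m) (toℚᵘ-fromℕ n) ⟨
  ℚ.toℚᵘ (fromℕ m) ℚᵘ.* ℚ.toℚᵘ (fromℕ n)      ≈⟨ ℚ.toℚᵘ-homo-* (fromℕ m) (fromℕ n) ⟨
  ℚ.toℚᵘ (fromℕ m ℚ.* fromℕ n)                ∎)
  where open ℚᵘ.≃-Reasoning

fromℕ-^ : ∀ m k → fromℕ (m ℕ.^ k) ≡ fromℕ m ^ℚ k
fromℕ-^ m zero    = ≡.refl
fromℕ-^ m (suc k) = ≡.trans (fromℕ-* m (m ℕ.^ k)) (≡.cong (fromℕ m ℚ.*_) (fromℕ-^ m k))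

fromℕ-mono-≤ : ∀ {m n} → m ℕ.≤ n → fromℕ m ℚ.≤ fromℕ n
fromℕ-mono-≤ {m} {n} m≤n = ℚ.toℚᵘ-cancel-≤ (ℚᵘ.≤-respˡ-≃ (ℚᵘ.≃-sym (toℚᵘ-fromℕ m))
  (ℚᵘ.≤-respʳ-≃ (ℚᵘ.≃-sym (toℚᵘ-fromℕ n)) (*≤* (ℤ.*-monoʳ-≤-nonNeg (+ 1) (ℤ.+≤+ m≤n)))))

fromℕ-cancel-≤ : ∀ {m n} → fromℕ m ℚ.≤ fromℕ n → m ℕ.≤ n
fromℕ-cancel-≤ {m} {n} h
  with ℚᵘ.≤-respˡ-≃ (toℚᵘ-fromℕ m) (ℚᵘ.≤-respʳ-≃ (toℚᵘ-fromℕ n) (ℚ.toℚᵘ-mono-≤ h))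
... | *≤* h′ = ℤ.drop‿+≤+ (≡.subst₂ ℤ._≤_ (ℤ.*-identityʳ (+ m)) (ℤ.*-identityʳ (+ n)) h′)

fromℕ-nonNeg : ∀ n → 0ℚ ℚ.≤ fromℕ n
fromℕ-nonNeg n = fromℕ-mono-≤ {0} {n} ℕ.z≤n

fromℕ-pos : ∀ {n} → 1 ℕ.≤ n → 0ℚ ℚ.< fromℕ n
fromℕ-pos 1≤n = ℚ.<-≤-trans (ℚ.positive⁻¹ 1ℚ) (fromℕ-mono-≤ 1≤n)

*-fromℕ-denominator : ∀ s → s ℚ.* fromℕ (↧ₙ s) ≡ ↥ s ℚ./ 1
*-fromℕ-denominator s@(mkℚ a b-1 _) = ℚ.toℚᵘ-injective (begin
  ℚ.toℚᵘ (s ℚ.* fromℕ (suc b-1))               ≈⟨ ℚ.toℚᵘ-homo-* s (fromℕ (suc b-1)) ⟩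
  mkℚᵘ a b-1 ℚᵘ.* ℚ.toℚᵘ (fromℕ (suc b-1))     ≈⟨ ℚᵘ.*-congˡ {mkℚᵘ a b-1} (toℚᵘ-fromℕ (suc b-1)) ⟩
  mkℚᵘ a b-1 ℚᵘ.* mkℚᵘ (+ suc b-1) 0
    ≈⟨ *≡* (≡.trans (ℤ.*-identityʳ _) (≡.cong (λ x → a ℤ.* + suc x) (≡.sym (ℕ.*-identityʳ b-1)))) ⟩
  mkℚᵘ a 0                                     ≈⟨ ℚ.toℚᵘ-fromℚᵘ (mkℚᵘ a 0) ⟨
  ℚ.toℚᵘ (a ℚ./ 1)                             ∎)
  where open ℚᵘ.≃-Reasoning

archimedean : ∀ q → ∃[ B ] q ℚ.< fromℕ B
archimedean q = suc ℤ.∣ ↥ q ∣ , ℚ.≰⇒> λ B≤q → ℕ.<⇒≱ (ℕ.n<1+n ℤ.∣ ↥ q ∣) (fromℕ-cancel-≤ (ℚ.≤-trans B≤q (bound q)))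
  where
  bound : ∀ q → q ℚ.≤ fromℕ ℤ.∣ ↥ q ∣
  bound q@(mkℚ a b-1 _) = ℚ.toℚᵘ-cancel-≤ (ℚᵘ.≤-respʳ-≃ (ℚᵘ.≃-sym (toℚᵘ-fromℕ ℤ.∣ a ∣))
    (*≤* (≡.subst₂ ℤ._≤_ (≡.sym (ℤ.*-identityʳ a)) (ℤ.pos-* ℤ.∣ a ∣ (suc b-1))
      (ℤ.≤-trans (i≤∣i∣ a) (ℤ.+≤+ (ℕ.m≤m*n ℤ.∣ a ∣ (suc b-1)))))))
    where
    i≤∣i∣ : ∀ i → i ℤ.≤ + ℤ.∣ i ∣
    i≤∣i∣ (+ n)    = ℤ.≤-refl
    i≤∣i∣ -[1+ n ] = ℤ.-≤+

*-mono-≤ : ∀ {p q r s} → 0ℚ ℚ.≤ p → 0ℚ ℚ.≤ r → p ℚ.≤ q → r ℚ.≤ s → p ℚ.* r ℚ.≤ q ℚ.* s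
*-mono-≤ {p} {q} {r} {s} 0≤p 0≤r p≤q r≤s = ℚ.≤-trans
  (ℚ.*-monoʳ-≤-nonNeg r {{ℚ.nonNegative 0≤r}} p≤q)
  (ℚ.*-monoˡ-≤-nonNeg q {{ℚ.nonNegative (ℚ.≤-trans 0≤p p≤q)}} r≤s)

*-pos : ∀ {p q} → 0ℚ ℚ.< p → 0ℚ ℚ.< q → 0ℚ ℚ.< p ℚ.* q
*-pos {p} {q} 0<p 0<q = ℚ.positive⁻¹ (p ℚ.* q) {{ℚ.pos*pos⇒pos p {{ℚ.positive 0<p}} q {{ℚ.positive 0<q}}}}

*-nonNeg : ∀ {p q} → 0ℚ ℚ.≤ p → 0ℚ ℚ.≤ q → 0ℚ ℚ.≤ p ℚ.* q
*-nonNeg {p} {q} 0≤p 0≤q =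
  ℚ.nonNegative⁻¹ (p ℚ.* q) {{ℚ.nonNeg*nonNeg⇒nonNeg p {{ℚ.nonNegative 0≤p}} q {{ℚ.nonNegative 0≤q}}}}

^-nonNeg : ∀ {p} k → 0ℚ ℚ.≤ p → 0ℚ ℚ.≤ p ^ℚ k
^-nonNeg zero    0≤p = ℚ.nonNegative⁻¹ 1ℚ
^-nonNeg (suc k) 0≤p = *-nonNeg 0≤p (^-nonNeg k 0≤p)

^-pos : ∀ {p} k → 0ℚ ℚ.< p → 0ℚ ℚ.< p ^ℚ k
^-pos zero    0<p = ℚ.positive⁻¹ 1ℚ
^-pos (suc k) 0<p = *-pos 0<p (^-pos k 0<p)

^-mono-≤ : ∀ {p q} k → 0ℚ ℚ.≤ p → p ℚ.≤ q → p ^ℚ k ℚ.≤ q ^ℚ k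
^-mono-≤ zero    0≤p p≤q = ℚ.≤-refl
^-mono-≤ (suc k) 0≤p p≤q = *-mono-≤ 0≤p (^-nonNeg k 0≤p) p≤q (^-mono-≤ k 0≤p p≤q)

^-mono-< : ∀ {p q} {k} → 1 ℕ.≤ k → 0ℚ ℚ.≤ p → p ℚ.< q → p ^ℚ k ℚ.< q ^ℚ k
^-mono-< {p} {q} {suc k} _ 0≤p p<q = ℚ.≤-<-trans
  (ℚ.*-monoˡ-≤-nonNeg p {{ℚ.nonNegative 0≤p}} (^-mono-≤ k 0≤p (ℚ.<⇒≤ p<q)))
  (ℚ.*-monoˡ-<-pos (q ^ℚ k) {{ℚ.positive (^-pos k (ℚ.≤-<-trans 0≤p p<q))}} p<q)

^-cancel-≤ : ∀ {p q k} → 1 ℕ.≤ k → 0ℚ ℚ.≤ q → p ^ℚ k ℚ.≤ q ^ℚ k → p ℚ.≤ q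
^-cancel-≤ 1≤k 0≤q h = ℚ.≮⇒≥ λ q<p → ℚ.<-irrefl ≡.refl (ℚ.<-≤-trans (^-mono-< 1≤k 0≤q q<p) h)

*-cancelʳ-≤ : ∀ {p q r} → 0ℚ ℚ.< r → p ℚ.* r ℚ.≤ q ℚ.* r → p ℚ.≤ q
*-cancelʳ-≤ {r = r} 0<r = ℚ.*-cancelʳ-≤-pos r {{ℚ.positive 0<r}}

1≤^ : ∀ {p} k → 1ℚ ℚ.≤ p → 1ℚ ℚ.≤ p ^ℚ k
1≤^ zero    1≤p = ℚ.≤-refl
1≤^ (suc k) 1≤p = *-mono-≤ 0≤1 0≤1 1≤p (1≤^ k 1≤p)
  where 0≤1 = ℚ.nonNegative⁻¹ 1ℚ

^-monoʳ-≤ : ∀ {p k l} → 1ℚ ℚ.≤ p → k ℕ.≤ l → p ^ℚ k ℚ.≤ p ^ℚ l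
^-monoʳ-≤ {l = l}     1≤p ℕ.z≤n       = 1≤^ l 1≤p
^-monoʳ-≤ {p} {suc k} 1≤p (ℕ.s≤s k≤l) =
  *-mono-≤ 0≤p (^-nonNeg k 0≤p) ℚ.≤-refl (^-monoʳ-≤ 1≤p k≤l)
  where 0≤p = ℚ.≤-trans (ℚ.nonNegative⁻¹ 1ℚ) 1≤p

-- Bernoulli's inequality `(1 + x)^k ≥ 1 + k x` at `x = (q - p) / p`, multiplied by `p^(k+1)` to
-- avoid division.
bernoulli : ∀ {p q} k → 0ℚ ℚ.≤ p → p ℚ.≤ q →
            p ^ℚ k ℚ.* (p ℚ.+ fromℕ k ℚ.* (q ℚ.- p)) ℚ.≤ p ℚ.* q ^ℚ k
bernoulli {p} {q} zero 0≤p p≤q = ℚ.≤-reflexive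
  (solve 2 (λ p q → con 1ℚ :* (p :+ con 0ℚ :* (q :- p)) := p :* con 1ℚ) ≡.refl p q)
  where open ℚ-Solver
bernoulli {p} {q} (suc k) 0≤p p≤q = begin
  p ^ℚ suc k ℚ.* (p ℚ.+ fromℕ (suc k) ℚ.* δ)
    ≡⟨ ≡.cong (λ x → p ^ℚ suc k ℚ.* (p ℚ.+ x ℚ.* δ)) (fromℕ-+ 1 k) ⟩
  p ^ℚ suc k ℚ.* (p ℚ.+ (1ℚ ℚ.+ fromℕ k) ℚ.* δ)
    -- The identity isolates the quadratic error `p^k k δ²`, which is nonnegative and is dropped
    -- next.
    ≡⟨ solve 4 (λ p P K δ → (p :* P) :* (p :+ (con 1ℚ :+ K) :* δ) :=
                            (p :+ δ) :* (P :* (p :+ K :* δ)) :- P :* (K :* (δ :* δ)))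
         ≡.refl p (p ^ℚ k) (fromℕ k) δ ⟩
  (p ℚ.+ δ) ℚ.* (p ^ℚ k ℚ.* (p ℚ.+ fromℕ k ℚ.* δ)) ℚ.- p ^ℚ k ℚ.* (fromℕ k ℚ.* (δ ℚ.* δ))
    ≤⟨ ℚ.+-monoʳ-≤ ((p ℚ.+ δ) ℚ.* (p ^ℚ k ℚ.* (p ℚ.+ fromℕ k ℚ.* δ)))
         (ℚ.neg-antimono-≤ (*-nonNeg (^-nonNeg k 0≤p) (*-nonNeg (fromℕ-nonNeg k) (*-nonNeg 0≤δ 0≤δ)))) ⟩
  (p ℚ.+ δ) ℚ.* (p ^ℚ k ℚ.* (p ℚ.+ fromℕ k ℚ.* δ)) ℚ.+ 0ℚ
    ≡⟨ ℚ.+-identityʳ _ ⟩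
  (p ℚ.+ δ) ℚ.* (p ^ℚ k ℚ.* (p ℚ.+ fromℕ k ℚ.* δ))
    ≡⟨ ≡.cong (ℚ._* (p ^ℚ k ℚ.* (p ℚ.+ fromℕ k ℚ.* δ))) (solve 2 (λ p q → p :+ (q :- p) := q) ≡.refl p q) ⟩
  q ℚ.* (p ^ℚ k ℚ.* (p ℚ.+ fromℕ k ℚ.* δ))
    ≤⟨ ℚ.*-monoˡ-≤-nonNeg q {{ℚ.nonNegative (ℚ.≤-trans 0≤p p≤q)}} (bernoulli k 0≤p p≤q) ⟩
  q ℚ.* (p ℚ.* q ^ℚ k)
    ≡⟨ solve 3 (λ p q Q → q :* (p :* Q) := p :* (q :* Q)) ≡.refl p q (q ^ℚ k) ⟩
  p ℚ.* q ^ℚ suc k                                 ∎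
  where
  open ℚ.≤-Reasoning
  open ℚ-Solver
  δ = q ℚ.- p
  0≤δ : 0ℚ ℚ.≤ δ
  0≤δ = ≡.subst (ℚ._≤ δ) (ℚ.+-inverseʳ p) (ℚ.+-monoˡ-≤ (ℚ.- p) p≤q)

-- By Bernoulli, `(q / p)^k` grows at least linearly in `k`, so it passes `C`.
scaled-power-< : ∀ {p q} C → 0ℚ ℚ.< p → p ℚ.< q → ∃[ k₀ ] ∀ k → k₀ ℕ.≤ k → C ℚ.* p ^ℚ k ℚ.< q ^ℚ k
scaled-power-< {p} {q} C 0<p p<q = k₀ , λ k k₀≤k →
  ℚ.*-cancelˡ-<-nonNeg p {{ℚ.nonNegative (ℚ.<⇒≤ 0<p)}} (begin-strict
    p ℚ.* (C ℚ.* p ^ℚ k)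
      ≡⟨ solve 3 (λ p C P → p :* (C :* P) := P :* (C :* p)) ≡.refl p C (p ^ℚ k) ⟩
    p ^ℚ k ℚ.* (C ℚ.* p)
      <⟨ ℚ.*-monoʳ-<-pos (p ^ℚ k) {{ℚ.positive (^-pos k 0<p)}} (large k k₀≤k) ⟩
    p ^ℚ k ℚ.* (p ℚ.+ fromℕ k ℚ.* δ)            ≤⟨ bernoulli k (ℚ.<⇒≤ 0<p) (ℚ.<⇒≤ p<q) ⟩
    p ℚ.* q ^ℚ k                                ∎)
  where
  open ℚ.≤-Reasoning
  open ℚ-Solver
  δ = q ℚ.- p
  0<δ : 0ℚ ℚ.< δ
  0<δ = ≡.subst (ℚ._< δ) (ℚ.+-inverseʳ p) (ℚ.+-monoˡ-< (ℚ.- p) p<q)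
  instance
    δ>0 : ℚ.Positive δ
    δ>0 = ℚ.positive 0<δ
    δ≢0 : ℚ.NonZero δ
    δ≢0 = ℚ.pos⇒nonZero δ
  -- Chosen above `C p / δ`, so that `k δ` exceeds `C p` for every `k ≥ k₀`.
  k₀ = proj₁ (archimedean ((C ℚ.* p) ℚ.* ℚ.1/ δ))
  large : ∀ k → k₀ ℕ.≤ k → C ℚ.* p ℚ.< p ℚ.+ fromℕ k ℚ.* δ
  large k k₀≤k = begin-strict
    C ℚ.* p                               ≡⟨ ℚ.*-identityʳ _ ⟨
    C ℚ.* p ℚ.* 1ℚ                        ≡⟨ ≡.cong ((C ℚ.* p) ℚ.*_) (ℚ.*-inverseˡ δ) ⟨
    C ℚ.* p ℚ.* (ℚ.1/ δ ℚ.* δ)            ≡⟨ ℚ.*-assoc (C ℚ.* p) (ℚ.1/ δ) δ ⟨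
    C ℚ.* p ℚ.* ℚ.1/ δ ℚ.* δ
      <⟨ ℚ.*-monoˡ-<-pos δ (proj₂ (archimedean ((C ℚ.* p) ℚ.* ℚ.1/ δ))) ⟩
    fromℕ k₀ ℚ.* δ
      ≤⟨ ℚ.*-monoʳ-≤-nonNeg δ {{ℚ.nonNegative (ℚ.<⇒≤ 0<δ)}} (fromℕ-mono-≤ k₀≤k) ⟩
    fromℕ k ℚ.* δ                         ≡⟨ ℚ.+-identityˡ _ ⟨
    0ℚ ℚ.+ fromℕ k ℚ.* δ                  <⟨ ℚ.+-monoˡ-< (fromℕ k ℚ.* δ) 0<p ⟩
    p ℚ.+ fromℕ k ℚ.* δ                   ∎

-- Comparison with rational powers of a natural number

divide : ∀ x {k} → 1 ℕ.≤ k → ∃[ w ] w ℚ.* fromℕ k ≡ x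
divide x {k} 1≤k = x ℚ.* ℚ.1/ fromℕ k , ≡.trans (ℚ.*-assoc x (ℚ.1/ fromℕ k) (fromℕ k))
  (≡.trans (≡.cong (x ℚ.*_) (ℚ.*-inverseˡ (fromℕ k))) (ℚ.*-identityʳ x))
  where
  instance
    k≢0 : ℚ.NonZero (fromℕ k)
    k≢0 = ℚ.pos⇒nonZero (fromℕ k) {{ℚ.positive (fromℕ-pos 1≤k)}}

-- s = (i − j) / b
record IsFraction (s : ℚ) (i j b : ℕ) : Set where
  constructor is-fraction
  field equation : s ℚ.* fromℕ b ℚ.+ fromℕ j ≡ fromℕ i

open IsFraction

minus-plus : ∀ x y → (x ℚ.- y) ℚ.+ y ≡ x
minus-plus = solve 2 (λ x y → (x :- y) :+ y := x) ≡.refl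
  where open ℚ-Solver

fraction : ∀ i j {b} → 1 ℕ.≤ b → ∃[ s ] IsFraction s i j b
fraction i j 1≤b = let s , sb≡i-j = divide (fromℕ i ℚ.- fromℕ j) 1≤b in
  s , is-fraction (≡.trans (≡.cong (ℚ._+ fromℕ j) sb≡i-j) (minus-plus (fromℕ i) (fromℕ j)))

canonical-fraction : ∀ s → IsFraction s (posPart (↥ s)) (negPart (↥ s)) (↧ₙ s)
canonical-fraction s = is-fraction (≡.trans
  (≡.cong (ℚ._+ fromℕ (negPart (↥ s))) (*-fromℕ-denominator s)) (parts (↥ s)))
  where
  parts : ∀ a → a ℚ./ 1 ℚ.+ fromℕ (negPart a) ≡ fromℕ (posPart a)
  parts (+ n)    = ℚ.+-identityʳ _
  parts -[1+ n ] = ℚ.+-inverseˡ (fromℕ (suc n))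

fraction-≤ : ∀ {s i j b s′ i′ j′ b′} → IsFraction s i j b → IsFraction s′ i′ j′ b′ → s ℚ.≤ s′ →
             i ℕ.* b′ ℕ.+ j′ ℕ.* b ℕ.≤ i′ ℕ.* b ℕ.+ j ℕ.* b′
fraction-≤ {s} {i} {j} {b} {s′} {i′} {j′} {b′} eq eq′ s≤s′ = fromℕ-cancel-≤ (begin
  fromℕ (i ℕ.* b′ ℕ.+ j′ ℕ.* b)               ≡⟨ hom i b′ j′ b ⟩
  fromℕ i ℚ.* B′ ℚ.+ J′ ℚ.* B                 ≡⟨ ≡.cong (λ x → x ℚ.* B′ ℚ.+ J′ ℚ.* B) (equation eq) ⟨
  (s ℚ.* B ℚ.+ J) ℚ.* B′ ℚ.+ J′ ℚ.* B
    ≡⟨ solve 5 (λ s B J B′ J′ → (s :* B :+ J) :* B′ :+ J′ :* B :=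
                                  s :* (B :* B′) :+ (J′ :* B :+ J :* B′)) ≡.refl s B J B′ J′ ⟩
  s ℚ.* (B ℚ.* B′) ℚ.+ (J′ ℚ.* B ℚ.+ J ℚ.* B′)
    ≤⟨ ℚ.+-monoˡ-≤ (J′ ℚ.* B ℚ.+ J ℚ.* B′)
         (ℚ.*-monoʳ-≤-nonNeg (B ℚ.* B′) {{ℚ.nonNegative (*-nonNeg (fromℕ-nonNeg b) (fromℕ-nonNeg b′))}} s≤s′) ⟩
  s′ ℚ.* (B ℚ.* B′) ℚ.+ (J′ ℚ.* B ℚ.+ J ℚ.* B′)
    ≡⟨ solve 5 (λ s B J B′ J′ → s :* (B :* B′) :+ (J′ :* B :+ J :* B′) :=
                                  (s :* B′ :+ J′) :* B :+ J :* B′) ≡.refl s′ B J B′ J′ ⟩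
  (s′ ℚ.* B′ ℚ.+ J′) ℚ.* B ℚ.+ J ℚ.* B′       ≡⟨ ≡.cong (λ x → x ℚ.* B ℚ.+ J ℚ.* B′) (equation eq′) ⟩
  fromℕ i′ ℚ.* B ℚ.+ J ℚ.* B′                 ≡⟨ hom i′ b j b′ ⟨
  fromℕ (i′ ℕ.* b ℕ.+ j ℕ.* b′)               ∎)
  where
  open ℚ.≤-Reasoning
  open ℚ-Solver
  B = fromℕ b
  J = fromℕ j
  B′ = fromℕ b′
  J′ = fromℕ j′
  hom : ∀ k l m n → fromℕ (k ℕ.* l ℕ.+ m ℕ.* n) ≡ fromℕ k ℚ.* fromℕ l ℚ.+ fromℕ m ℚ.* fromℕ n
  hom k l m n = ≡.trans (fromℕ-+ (k ℕ.* l) (m ℕ.* n)) (≡.cong₂ ℚ._+_ (fromℕ-* k l) (fromℕ-* m n))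

-- Raise the hypothesis to the power `b′`, compare exponents of `ν` after cross-multiplication, and
-- take a `b`-th root. With equal exponents this changes the fraction that represents `s`; otherwise
-- it is monotonicity in the exponent.
power-≤-exponent : ∀ {ν q s s′ i j b i′ j′ b′} → 1ℚ ℚ.≤ ν → 0ℚ ℚ.≤ q → 1 ℕ.≤ b →
  IsFraction s i j b → IsFraction s′ i′ j′ b′ → s ℚ.≤ s′ →
  q ^ℚ b ℚ.* ν ^ℚ j ℚ.≤ ν ^ℚ i → q ^ℚ b′ ℚ.* ν ^ℚ j′ ℚ.≤ ν ^ℚ i′
power-≤-exponent {ν} {q} {_} {_} {i} {j} {b} {i′} {j′} {b′} 1≤ν 0≤q 1≤b frac frac′ s≤s′ h =
  ^-cancel-≤ 1≤b (^-nonNeg i′ 0≤ν) (*-cancelʳ-≤ (^-pos (j ℕ.* b′) 0<ν) (begin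
    (q ^ℚ b′ ℚ.* ν ^ℚ j′) ^ℚ b ℚ.* ν ^ℚ (j ℕ.* b′)
      ≡⟨ ≡.cong (ℚ._* ν ^ℚ (j ℕ.* b′)) (distrib b′ j′ b) ⟩
    q ^ℚ (b′ ℕ.* b) ℚ.* ν ^ℚ (j′ ℕ.* b) ℚ.* ν ^ℚ (j ℕ.* b′)
      ≡⟨ ≡.cong (λ x → q ^ℚ x ℚ.* ν ^ℚ (j′ ℕ.* b) ℚ.* ν ^ℚ (j ℕ.* b′)) (ℕ.*-comm b′ b) ⟩
    q ^ℚ (b ℕ.* b′) ℚ.* ν ^ℚ (j′ ℕ.* b) ℚ.* ν ^ℚ (j ℕ.* b′)
      ≡⟨ solve 3 (λ x y z → x :* y :* z := x :* z :* y) ≡.refl (q ^ℚ (b ℕ.* b′)) (ν ^ℚ (j′ ℕ.* b)) (ν ^ℚ (j ℕ.* b′)) ⟩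
    q ^ℚ (b ℕ.* b′) ℚ.* ν ^ℚ (j ℕ.* b′) ℚ.* ν ^ℚ (j′ ℕ.* b)
      ≡⟨ ≡.cong (ℚ._* ν ^ℚ (j′ ℕ.* b)) (distrib b j b′) ⟨
    (q ^ℚ b ℚ.* ν ^ℚ j) ^ℚ b′ ℚ.* ν ^ℚ (j′ ℕ.* b)
      ≤⟨ ℚ.*-monoʳ-≤-nonNeg (ν ^ℚ (j′ ℕ.* b)) {{ℚ.nonNegative (^-nonNeg (j′ ℕ.* b) 0≤ν)}}
           (^-mono-≤ b′ (*-nonNeg (^-nonNeg b 0≤q) (^-nonNeg j 0≤ν)) h) ⟩
    (ν ^ℚ i) ^ℚ b′ ℚ.* ν ^ℚ (j′ ℕ.* b)                  ≡⟨ collect i b′ (j′ ℕ.* b) ⟩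
    ν ^ℚ (i ℕ.* b′ ℕ.+ j′ ℕ.* b)                        ≤⟨ ^-monoʳ-≤ 1≤ν (fraction-≤ frac frac′ s≤s′) ⟩
    ν ^ℚ (i′ ℕ.* b ℕ.+ j ℕ.* b′)                        ≡⟨ collect i′ b (j ℕ.* b′) ⟨
    (ν ^ℚ i′) ^ℚ b ℚ.* ν ^ℚ (j ℕ.* b′)                  ∎))
  where
  open ℚ.≤-Reasoning
  open ℚ-Solver
  0<ν : 0ℚ ℚ.< ν
  0<ν = ℚ.<-≤-trans (ℚ.positive⁻¹ 1ℚ) 1≤ν
  0≤ν = ℚ.<⇒≤ 0<ν
  distrib : ∀ x y z → (q ^ℚ x ℚ.* ν ^ℚ y) ^ℚ z ≡ q ^ℚ (x ℕ.* z) ℚ.* ν ^ℚ (y ℕ.* z)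
  distrib x y z = ≡.trans (^-distrib-* (q ^ℚ x) (ν ^ℚ y) z) (≡.cong₂ ℚ._*_ (^-assocʳ q x z) (^-assocʳ ν y z))
  collect : ∀ x y z → (ν ^ℚ x) ^ℚ y ℚ.* ν ^ℚ z ≡ ν ^ℚ (x ℕ.* y ℕ.+ z)
  collect x y z = ≡.trans (≡.cong (ℚ._* ν ^ℚ z) (^-assocʳ ν x y)) (≡.sym (^-homo-* ν (x ℕ.* y) z))

1≤denominator : ∀ s → 1 ℕ.≤ ↧ₙ s
1≤denominator (mkℚ _ _ _) = ℕ.s≤s ℕ.z≤n

module _ {n} (1≤n : 1 ℕ.≤ n) where

  private
    1≤ν : 1ℚ ℚ.≤ fromℕ n
    1≤ν = fromℕ-mono-≤ 1≤n

  ≤^⇒fraction : ∀ {q s i j b} → 0ℚ ℚ.≤ q → 1 ℕ.≤ b → IsFraction s i j b →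
                q ≤[ n ^ s ] → q ^ℚ b ℚ.* fromℕ n ^ℚ j ℚ.≤ fromℕ n ^ℚ i
  -- Here `q = 0`, and the positive denominator makes the left-hand side vanish.
  ≤^⇒fraction {q} {s} {i} {j} {suc b} 0≤q _ _ (inj₁ q≤0) = begin
    q ℚ.* q ^ℚ b ℚ.* fromℕ n ^ℚ j
      ≡⟨ ≡.cong (λ x → x ℚ.* q ^ℚ b ℚ.* fromℕ n ^ℚ j) (ℚ.≤-antisym q≤0 0≤q) ⟩
    0ℚ ℚ.* q ^ℚ b ℚ.* fromℕ n ^ℚ j
      ≡⟨ solve 2 (λ x y → con 0ℚ :* x :* y := con 0ℚ) ≡.refl (q ^ℚ b) (fromℕ n ^ℚ j) ⟩
    0ℚ                               ≤⟨ ^-nonNeg i (fromℕ-nonNeg n) ⟩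
    fromℕ n ^ℚ i                     ∎
    where
    open ℚ.≤-Reasoning
    open ℚ-Solver
  ≤^⇒fraction {s = s} 0≤q _ frac (inj₂ h) =
    power-≤-exponent 1≤ν 0≤q (1≤denominator s) (canonical-fraction s) frac ℚ.≤-refl h

  fraction⇒≤^ : ∀ {q s i j b} → 0ℚ ℚ.≤ q → 1 ℕ.≤ b → IsFraction s i j b →
                q ^ℚ b ℚ.* fromℕ n ^ℚ j ℚ.≤ fromℕ n ^ℚ i → q ≤[ n ^ s ]
  fraction⇒≤^ {s = s} 0≤q 1≤b frac h =
    inj₂ (power-≤-exponent 1≤ν 0≤q 1≤b frac (canonical-fraction s) ℚ.≤-refl h)

  ≤^-monoʳ : ∀ {q} s s′ → s ℚ.≤ s′ → q ≤[ n ^ s ] → q ≤[ n ^ s′ ]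
  ≤^-monoʳ s s′ s≤s′ (inj₁ q≤0) = inj₁ q≤0
  ≤^-monoʳ {q} s s′ s≤s′ (inj₂ h) with ℚ.≤-total q 0ℚ
  ... | inj₁ q≤0 = inj₁ q≤0
  ... | inj₂ 0≤q = inj₂ (power-≤-exponent 1≤ν 0≤q (1≤denominator s)
          (canonical-fraction s) (canonical-fraction s′) s≤s′ h)

  ≤^-monoˡ : ∀ {p q} s → p ℚ.≤ q → q ≤[ n ^ s ] → p ≤[ n ^ s ]
  ≤^-monoˡ s p≤q (inj₁ q≤0) = inj₁ (ℚ.≤-trans p≤q q≤0)
  ≤^-monoˡ {p} {q} s p≤q (inj₂ h) with ℚ.≤-total p 0ℚ
  ... | inj₁ p≤0 = inj₁ p≤0
  ... | inj₂ 0≤p = inj₂ (ℚ.≤-trans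
          (ℚ.*-monoʳ-≤-nonNeg (fromℕ n ^ℚ negPart (↥ s)) {{ℚ.nonNegative (^-nonNeg (negPart (↥ s)) (fromℕ-nonNeg n))}}
            (^-mono-≤ (↧ₙ s) 0≤p p≤q)) h)

  ≤^-base : ∀ {q} s k → 0ℚ ℚ.≤ q → q ≤[ (n ℕ.^ k) ^ s ] → q ≤[ n ^ s ℚ.* fromℕ k ]
  ≤^-base s k 0≤q (inj₁ q≤0) = inj₁ q≤0
  ≤^-base {q} s k 0≤q (inj₂ h) = fraction⇒≤^ 0≤q (1≤denominator s) frac
    (≡.subst₂ (λ x y → q ^ℚ b ℚ.* x ℚ.≤ y) (base j) (base i) h)
    where
    i = posPart (↥ s)
    j = negPart (↥ s)
    b = ↧ₙ s
    base : ∀ m → fromℕ (n ℕ.^ k) ^ℚ m ≡ fromℕ n ^ℚ (k ℕ.* m)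
    base m = ≡.trans (≡.cong (_^ℚ m) (fromℕ-^ n k)) (^-assocʳ (fromℕ n) k m)
    frac : IsFraction (s ℚ.* fromℕ k) (k ℕ.* i) (k ℕ.* j) b
    frac = is-fraction (begin
      s ℚ.* fromℕ k ℚ.* fromℕ b ℚ.+ fromℕ (k ℕ.* j)
        ≡⟨ ≡.cong (s ℚ.* fromℕ k ℚ.* fromℕ b ℚ.+_) (fromℕ-* k j) ⟩
      s ℚ.* fromℕ k ℚ.* fromℕ b ℚ.+ fromℕ k ℚ.* fromℕ j
        ≡⟨ solve 4 (λ s k b j → s :* k :* b :+ k :* j := k :* (s :* b :+ j)) ≡.refl s (fromℕ k) (fromℕ b) (fromℕ j) ⟩
      fromℕ k ℚ.* (s ℚ.* fromℕ b ℚ.+ fromℕ j)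
        ≡⟨ ≡.cong (fromℕ k ℚ.*_) (equation (canonical-fraction s)) ⟩
      fromℕ k ℚ.* fromℕ i                              ≡⟨ fromℕ-* k i ⟨
      fromℕ (k ℕ.* i)                                  ∎)
      where
      open ≡.≡-Reasoning
      open ℚ-Solver

  -- If `(i - j) / b` is the reduced form of `s k`, then `s` is `(i - j) / (k b)`, and the two
  -- inequalities coincide.
  ≤^-root : ∀ {q} s k → 1 ℕ.≤ k → 0ℚ ℚ.≤ q → (q ^ℚ k) ≤[ n ^ s ℚ.* fromℕ k ] → q ≤[ n ^ s ]
  ≤^-root {q} s k 1≤k 0≤q h = fraction⇒≤^ 0≤q (ℕ.*-mono-≤ 1≤k (1≤denominator S)) frac
    (≡.subst (λ x → x ℚ.* fromℕ n ^ℚ j ℚ.≤ fromℕ n ^ℚ i) (^-assocʳ q k b)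
      (≤^⇒fraction (^-nonNeg k 0≤q) (1≤denominator S) (canonical-fraction S) h))
    where
    S = s ℚ.* fromℕ k
    i = posPart (↥ S)
    j = negPart (↥ S)
    b = ↧ₙ S
    frac : IsFraction s i j (k ℕ.* b)
    frac = is-fraction (≡.trans (≡.cong (ℚ._+ fromℕ j)
      (≡.trans (≡.cong (s ℚ.*_) (fromℕ-* k b)) (≡.sym (ℚ.*-assoc s (fromℕ k) (fromℕ b)))))
      (equation (canonical-fraction S)))

n≤2^n : ∀ k → k ℕ.≤ 2 ℕ.^ k
n≤2^n zero    = ℕ.z≤n
n≤2^n (suc k) = ℕ.+-mono-≤ (ℕ.m^n>0 2 k) (ℕ.≤-trans (n≤2^n k) (ℕ.≤-reflexive (≡.sym (ℕ.+-identityʳ _))))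

module _ {n} (2≤n : 2 ℕ.≤ n) where

  private
    ν = fromℕ n
    1≤n : 1 ℕ.≤ n
    1≤n = ℕ.≤-trans (ℕ.s≤s ℕ.z≤n) 2≤n

  k≤n^k : ∀ k → k ℕ.≤ n ℕ.^ k
  k≤n^k k = ℕ.≤-trans (n≤2^n k) (ℕ.^-monoˡ-≤ k 2≤n)

  -- Descending from `ν ^ B`, the search stops at the last power still above `x`, which overshoots
  -- by at most a factor `ν`.
  power-bracket : ∀ {x} B → 1ℚ ℚ.≤ x → x ℚ.≤ ν ^ℚ B → ∃[ i ] (x ℚ.≤ ν ^ℚ i × ν ^ℚ i ℚ.≤ ν ℚ.* x)
  power-bracket zero 1≤x x≤1 = 0 , x≤1 ,
    *-mono-≤ (ℚ.nonNegative⁻¹ 1ℚ) (ℚ.nonNegative⁻¹ 1ℚ) (fromℕ-mono-≤ 1≤n) 1≤x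
  power-bracket {x} (suc B) 1≤x x≤ with ℚ.≤-total x (ν ^ℚ B)
  ... | inj₁ x≤ν^B = power-bracket B 1≤x x≤ν^B
  ... | inj₂ ν^B≤x = suc B , x≤ , ℚ.*-monoˡ-≤-nonNeg ν {{ℚ.nonNegative (fromℕ-nonNeg n)}} ν^B≤x

  below-power : ∀ x → ∃[ k ] x ℚ.≤ ν ^ℚ k
  below-power x = let B , x<B = archimedean x in
    B , ℚ.≤-trans (ℚ.<⇒≤ x<B) (≡.subst (fromℕ B ℚ.≤_) (fromℕ-^ n B) (fromℕ-mono-≤ (k≤n^k B)))

  scale-above-1 : ∀ {x} → 0ℚ ℚ.< x → ∃[ j ] 1ℚ ℚ.≤ x ℚ.* ν ^ℚ j
  scale-above-1 {x} 0<x = let j , x⁻¹≤ = below-power (ℚ.1/ x) in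
    j , ≡.subst (ℚ._≤ x ℚ.* ν ^ℚ j) (ℚ.*-inverseʳ x) (ℚ.*-monoˡ-≤-nonNeg x {{ℚ.nonNegative (ℚ.<⇒≤ 0<x)}} x⁻¹≤)
    where
    instance
      x≢0 : ℚ.NonZero x
      x≢0 = ℚ.pos⇒nonZero x {{ℚ.positive 0<x}}

  fraction-between : ∀ {p q i j b} → 0ℚ ℚ.< p → 0ℚ ℚ.< q → 1 ℕ.≤ b →
    p ^ℚ b ℚ.* ν ^ℚ j ℚ.≤ ν ^ℚ i → ν ^ℚ i ℚ.< q ^ℚ b ℚ.* ν ^ℚ j →
    ∃[ s ] (p ≤[ n ^ s ] × ¬ (q ≤[ n ^ s ]))
  fraction-between {i = i} {j} {b} 0<p 0<q 1≤b lower upper = let s , frac = fraction i j 1≤b in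
    s , fraction⇒≤^ 1≤n (ℚ.<⇒≤ 0<p) 1≤b frac lower ,
    λ h → ℚ.<-irrefl ≡.refl (ℚ.<-≤-trans upper (≤^⇒fraction 1≤n (ℚ.<⇒≤ 0<q) 1≤b frac h))

  -- An approximate logarithm. Once `ν p^b < q^b`, the interval from `p^b` to `q^b` is wide enough,
  -- on the multiplicative scale, to contain an integer power of `ν`; its `b`-th root lies between
  -- `p` and `q`.
  power-dense : ∀ {p q} → 0ℚ ℚ.< p → p ℚ.< q → ∃[ s ] (p ≤[ n ^ s ] × ¬ (q ≤[ n ^ s ]))
  power-dense {p} {q} 0<p p<q =
    let b₀ , νp^b<q^b    = scaled-power-< ν 0<p p<q
        b                = suc b₀
        -- The factor `ν ^ j` lifts `p^b` to at least `1`, where bracketing by natural powers is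
        -- possible; it becomes the `- j` in the numerator.
        j , 1≤x          = scale-above-1 (^-pos b 0<p)
        B , x≤ν^B        = below-power (p ^ℚ b ℚ.* ν ^ℚ j)
        i , x≤ν^i , ν^i≤ = power-bracket B 1≤x x≤ν^B
    in fraction-between {i = i} {j} {b} 0<p (ℚ.<-trans 0<p p<q) (ℕ.s≤s ℕ.z≤n) x≤ν^i
         (upper b j i (νp^b<q^b b (ℕ.n≤1+n b₀)) ν^i≤)
    where
    open ℚ.≤-Reasoning
    upper : ∀ b j i → ν ℚ.* p ^ℚ b ℚ.< q ^ℚ b → ν ^ℚ i ℚ.≤ ν ℚ.* (p ^ℚ b ℚ.* ν ^ℚ j) →
            ν ^ℚ i ℚ.< q ^ℚ b ℚ.* ν ^ℚ j
    upper b j i νp^b<q^b ν^i≤ = begin-strict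
      ν ^ℚ i                       ≤⟨ ν^i≤ ⟩
      ν ℚ.* (p ^ℚ b ℚ.* ν ^ℚ j)    ≡⟨ ℚ.*-assoc ν (p ^ℚ b) (ν ^ℚ j) ⟨
      ν ℚ.* p ^ℚ b ℚ.* ν ^ℚ j
        <⟨ ℚ.*-monoˡ-<-pos (ν ^ℚ j) {{ℚ.positive (^-pos j (fromℕ-pos 1≤n))}} νp^b<q^b ⟩
      q ^ℚ b ℚ.* ν ^ℚ j            ∎

-- Membership in scaled cuts and in powers

module _ (c : ℚ) .{{c>0 : ℚ.Positive c}} (x : ℝ) where

  private
    instance
      c≢0 : ℚ.NonZero c
      c≢0 = ℚ.pos⇒nonZero c

  scale-∋⁺ : ∀ {t} → x ∋ t → scale c x ∋ (t ℚ.* c)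
  scale-∋⁺ {t} = ≡.subst (x ∋_) (≡.sym (≡.trans (ℚ.*-assoc t c (ℚ.1/ c))
    (≡.trans (≡.cong (t ℚ.*_) (ℚ.*-inverseʳ c)) (ℚ.*-identityʳ t))))

  scale-∋⁻ : ∀ {q} → scale c x ∋ q → ∃[ p ] (p ℚ.* c ≡ q × x ∋ p)
  scale-∋⁻ {q} x∋ = q ℚ.* ℚ.1/ c , ≡.trans (ℚ.*-assoc q (ℚ.1/ c) c)
    (≡.trans (≡.cong (q ℚ.*_) (ℚ.*-inverseˡ c)) (ℚ.*-identityʳ q)) , x∋

·-∋⁺ : ∀ {k x t} → 1 ℕ.≤ k → x ∋ t → (k · x) ∋ (t ℚ.* fromℕ k)
·-∋⁺ {suc k} {x} _ = scale-∋⁺ (fromℕ (suc k)) {{ℚ.normalize-pos (suc k) 1}} x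

·-∋⁻ : ∀ k {x q} → 0ℚ ℚ.≤ q → (k · x) ∋ q → ∃[ p ] (p ℚ.* fromℕ k ≡ q × x ∋ p)
·-∋⁻ zero        0≤q q<0 = contradiction (ℚ.≤-<-trans 0≤q q<0) (ℚ.<-irrefl ≡.refl)
·-∋⁻ (suc k) {x} _   = scale-∋⁻ (fromℕ (suc k)) {{ℚ.normalize-pos (suc k) 1}} x

fromℕ-*-reciprocal : ∀ k → fromℕ (suc k) ℚ.* (+ 1 ℚ./ suc k) ≡ 1ℚ
fromℕ-*-reciprocal k = ℚ.toℚᵘ-injective (begin
  ℚ.toℚᵘ (fromℕ (suc k) ℚ.* (+ 1 ℚ./ suc k))
    ≈⟨ ℚ.toℚᵘ-homo-* (fromℕ (suc k)) (+ 1 ℚ./ suc k) ⟩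
  ℚ.toℚᵘ (fromℕ (suc k)) ℚᵘ.* ℚ.toℚᵘ (+ 1 ℚ./ suc k)
    ≈⟨ ℚᵘ.*-cong (toℚᵘ-fromℕ (suc k)) (ℚ.toℚᵘ-fromℚᵘ (mkℚᵘ (+ 1) k)) ⟩
  mkℚᵘ (+ suc k) 0 ℚᵘ.* mkℚᵘ (+ 1) k                      ≈⟨ *≡* (≡.cong (λ x → + suc x)
      (≡.trans (ℕ.*-identityʳ _) (≡.trans (ℕ.*-identityʳ k) (≡.sym (≡.trans (ℕ.+-identityʳ _) (ℕ.+-identityʳ k)))))) ⟩
  ℚ.toℚᵘ 1ℚ                                               ∎)
  where
  open ℚᵘ.≃-Reasoning

/-∋⁺ : ∀ {k x t} → 1 ℕ.≤ k → x ∋ (t ℚ.* fromℕ k) → (x / k) ∋ t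
/-∋⁺ {suc k} {x} {t} _ x∋ = ≡.subst ((x / suc k) ∋_)
  (≡.trans (ℚ.*-assoc t (fromℕ (suc k)) (+ 1 ℚ./ suc k))
    (≡.trans (≡.cong (t ℚ.*_) (fromℕ-*-reciprocal k)) (ℚ.*-identityʳ t)))
  (scale-∋⁺ (+ 1 ℚ./ suc k) {{ℚ.normalize-pos 1 (suc k)}} x x∋)

^-∋⁻ : ∀ n {x q} → 0ℚ ℚ.≤ q → (n ^ x) ∋ q → 1 ℕ.≤ n × ∃[ q′ ] ∃[ s ] (q ℚ.< q′ × x ∋ s × q′ ≤[ n ^ s ])
^-∋⁻ zero    0≤q q<0 = contradiction (ℚ.≤-<-trans 0≤q q<0) (ℚ.<-irrefl ≡.refl)
^-∋⁻ (suc n) _   h   = ℕ.s≤s ℕ.z≤n , h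

^-∋⁺ : ∀ {n x q q′ s} → 1 ℕ.≤ n → q ℚ.< q′ → x ∋ s → q′ ≤[ n ^ s ] → (n ^ x) ∋ q
^-∋⁺ {suc n} _ q<q′ x∋s q′≤ = _ , _ , q<q′ , x∋s , q′≤

root-∋⁻ : ∀ n k {q} → 0ℚ ℚ.≤ q → (n ^ fromℚ (+ 1 ℚ./ suc k)) ∋ q → q ^ℚ suc k ℚ.< fromℕ n
root-∋⁻ n k {q} 0≤q h =
  let 1≤n , q′ , s , q<q′ , s<1/k , q′≤n^s = ^-∋⁻ n 0≤q h
      0≤q′ = ℚ.≤-trans 0≤q (ℚ.<⇒≤ q<q′)
      1/k-fraction : IsFraction (+ 1 ℚ./ suc k) 1 0 (suc k)
      1/k-fraction = is-fraction (≡.trans (ℚ.+-identityʳ _)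
        (≡.trans (ℚ.*-comm (+ 1 ℚ./ suc k) (fromℕ (suc k))) (fromℕ-*-reciprocal k)))
  in ℚ.<-≤-trans (^-mono-< {k = suc k} (ℕ.s≤s ℕ.z≤n) 0≤q q<q′)
       (≡.subst₂ ℚ._≤_ (ℚ.*-identityʳ _) (ℚ.*-identityʳ _)
         (≤^⇒fraction 1≤n 0≤q′ (ℕ.s≤s ℕ.z≤n) 1/k-fraction
           (≤^-monoʳ 1≤n s (+ 1 ℚ./ suc k) (ℚ.<⇒≤ s<1/k) q′≤n^s)))

1-^ℚ : ∀ k → 1ℚ ^ℚ k ≡ 1ℚ
1-^ℚ zero    = ≡.refl
1-^ℚ (suc k) = ≡.trans (ℚ.*-identityˡ _) (1-^ℚ k)

1≤1^ : ∀ s → 1ℚ ≤[ 1 ^ s ]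
1≤1^ s = inj₂ (ℚ.≤-reflexive (≡.trans (≡.cong₂ ℚ._*_ (1-^ℚ (↧ₙ s)) (1-^ℚ (negPart (↥ s))))
  (≡.trans (ℚ.*-identityˡ 1ℚ) (≡.sym (1-^ℚ (posPart (↥ s)))))))

-- Two exponents s < s⁺ with q < n ^ s and n ^ s⁺ < q₂; the gap between them
-- lets a bound by s⁺ on every element of a set pass to its infimum as a strict
-- bound by s.
record PowerGap (n : ℕ) (q q₂ : ℚ) : Set where
  field
    a c s s⁺ : ℚ
    q<a      : q ℚ.< a
    a≤n^s    : a ≤[ n ^ s ]
    s<s⁺     : s ℚ.< s⁺
    n^s⁺<c   : ¬ (c ≤[ n ^ s⁺ ])
    0<c      : 0ℚ ℚ.< c
    c<q₂     : c ℚ.< q₂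

-- With `q < a < b < c < q₂`, the exponent `s` separates `a` from `b` and `s⁺` separates `b` from
-- `c`. The middle value `b` forces `s < s⁺`.
power-gap : ∀ {n} → 2 ℕ.≤ n → ∀ {q q₂} → 0ℚ ℚ.≤ q → q ℚ.< q₂ → PowerGap n q q₂
power-gap {n} 2≤n {q} {q₂} 0≤q q<q₂ with ℚ.<-dense q<q₂
... | b , q<b , b<q₂ with ℚ.<-dense q<b | ℚ.<-dense b<q₂
...   | a , q<a , a<b | c , b<c , c<q₂ =
  assemble (power-dense 2≤n (ℚ.≤-<-trans 0≤q q<a) a<b) (power-dense 2≤n (ℚ.≤-<-trans 0≤q q<b) b<c)
  where
  assemble : ∃[ s ] (a ≤[ n ^ s ] × ¬ (b ≤[ n ^ s ])) → ∃[ s ] (b ≤[ n ^ s ] × ¬ (c ≤[ n ^ s ])) → PowerGap n q q₂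
  assemble (s , a≤n^s , n^s<b) (s⁺ , b≤n^s⁺ , n^s⁺<c) = record
    { a      = a
    ; c      = c
    ; s      = s
    ; s⁺     = s⁺
    ; q<a    = q<a
    ; a≤n^s  = a≤n^s
    ; s<s⁺   = ℚ.≰⇒> λ s⁺≤s → n^s<b (≤^-monoʳ (ℕ.≤-trans (ℕ.s≤s ℕ.z≤n) 2≤n) s⁺ s s⁺≤s b≤n^s⁺)
    ; n^s⁺<c = n^s⁺<c
    ; 0<c    = ℚ.≤-<-trans 0≤q (ℚ.<-trans q<b b<c)
    ; c<q₂   = c<q₂
    }

-- From ranks of powers to the asymptotic rank

module AsymptoticBound {ℓ ℓ₁ ℓ₂} (F : HeytingField ℓ ℓ₁ ℓ₂) {d n : ℕ} (3≤d : 3 ℕ.≤ d) (1≤n : 1 ℕ.≤ n)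
  (T : Tensors.Tensor F {d} (λ _ → Fin n)) {ρ : ℝ} (asymptotic : Tensors.IsAsymptoticRank F T ρ) where

  open Tensors F
  open Restrictions F

  private
    D = d ∸ 1
    E = Graph.size (K d)
    1≤d : 1 ℕ.≤ d
    1≤d = ℕ.≤-trans (ℕ.s≤s ℕ.z≤n) 3≤d
    1≤D : 1 ℕ.≤ D
    1≤D = ℕ.∸-monoˡ-≤ {2} {d} 1 (ℕ.≤-trans (ℕ.n≤1+n 2) 3≤d)
    1≤E : 1 ℕ.≤ E
    1≤E = ℕ.n≢0⇒n>0 λ E≡0 → ℕ.<⇒≢ (ℕ.*-mono-≤ 1≤d 1≤D)
      (≡.trans (≡.cong (2 ℕ.*_) (≡.sym E≡0)) (2*size d))

    R : ℕ → ℕ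
    R = proj₁ asymptotic

    -- With `ε = q₁ - q₂` in the limit, `q₁` below `ρ` puts `q₂` below all late roots.
    R-lower : ∀ {q₂ q₁} → 0ℚ ℚ.≤ q₂ → q₂ ℚ.< q₁ → ρ ∋ q₁ →
              ∃[ N ] ∀ k → N ℕ.< k → q₂ ^ℚ k ℚ.< fromℕ (R k)
    R-lower {q₂} {q₁} 0≤q₂ q₂<q₁ ρ∋q₁ =
      let N , close = proj₂ (proj₂ asymptotic) (q₁ ℚ.- q₂)
            (≡.subst (ℚ._< q₁ ℚ.- q₂) (ℚ.+-inverseʳ q₂) (ℚ.+-monoˡ-< (ℚ.- q₂) q₂<q₁))
      -- The sequence starts with the first power, so its terms from index `N` on concern powers
      -- greater than `N`.
      in N , λ { (suc k) (ℕ.s≤s N≤k) → root-∋⁻ (R (suc k)) k 0≤q₂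
           (≡.subst ((R (suc k) ^ fromℚ (+ 1 ℚ./ suc k)) ∋_) (minus-minus q₁ q₂) (proj₂ (close k N≤k) q₁ ρ∋q₁)) }
      where
      minus-minus : ∀ x y → x ℚ.- (x ℚ.- y) ≡ y
      minus-minus = solve 2 (λ x y → x :- (x :- y) := y) ≡.refl
        where open ℚ-Solver

    R-upper : ∀ k {r} → HasDecomposition (graphTensor (K d) (n ℕ.^ k ℕ.* n ℕ.^ k)) r → R (d ℕ.* k) ℕ.≤ r
    R-upper k hd = proj₂ (proj₁ (proj₂ asymptotic) (d ℕ.* k)) _ (power-decomposition T k hd)

    k≤d*k : ∀ k → k ℕ.≤ d ℕ.* k
    k≤d*k k = ≡.subst (ℕ._≤ d ℕ.* k) (ℕ.*-identityˡ k) (ℕ.*-monoˡ-≤ k 1≤d)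

  -- One label gives one product, so `R` is at most `1` at every multiple of `d`, and powers of a
  -- number `q₂ ≥ 1` cannot stay below that.
  ρ≤1 : n ≡ 1 → ∀ {q₂ q₁} → 0ℚ ℚ.≤ q₂ → q₂ ℚ.< q₁ → ρ ∋ q₁ → q₂ ℚ.< 1ℚ
  ρ≤1 ≡.refl {q₂} 0≤q₂ q₂<q₁ ρ∋q₁ =
    let N , lower = R-lower 0≤q₂ q₂<q₁ ρ∋q₁
        j = d ℕ.* suc N
        r = (1 ℕ.^ suc N ℕ.* 1 ℕ.^ suc N) ℕ.^ E
        r≡1 : r ≡ 1
        r≡1 = ≡.trans (≡.cong (ℕ._^ E) (≡.cong₂ ℕ._*_ (ℕ.^-zeroˡ (suc N)) (ℕ.^-zeroˡ (suc N)))) (ℕ.^-zeroˡ E)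
        q₂^j<1 : q₂ ^ℚ j ℚ.< 1ℚ
        q₂^j<1 = ℚ.<-≤-trans (lower j (k≤d*k (suc N)))
          (fromℕ-mono-≤ {n = 1} (ℕ.≤-trans (R-upper (suc N) (graphTensor-decomposition (K d) _)) (ℕ.≤-reflexive r≡1)))
    in ℚ.≰⇒> λ 1≤q₂ → ℚ.<-irrefl ≡.refl (ℚ.<-≤-trans q₂^j<1 (1≤^ j 1≤q₂))



  module _ (2≤n : 2 ℕ.≤ n) {c s⁺ q₂ q₁} (0<c : 0ℚ ℚ.< c) (n^s⁺<c : ¬ (c ≤[ n ^ s⁺ ]))
    (c<q₂ : c ℚ.< q₂) (q₂<q₁ : q₂ ℚ.< q₁) (ρ∋q₁ : ρ ∋ q₁) where

    private
      0≤c : 0ℚ ℚ.≤ c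
      0≤c = ℚ.<⇒≤ 0<c
      0<q₂ : 0ℚ ℚ.< q₂
      0<q₂ = ℚ.<-trans 0<c c<q₂

    -- The `(dk)`-th root of `(n^(2k))^v` is `n^w` with `w = 2v / d`; since `n^s⁺ < c ≤ n^w`, the
    -- exponent `w` exceeds `s⁺`.
    exponent-above : ∀ k v → 1 ℕ.≤ k → (c ^ℚ (d ℕ.* k)) ≤[ (n ℕ.^ k ℕ.* n ℕ.^ k) ^ v ] →
                     s⁺ ℚ.* fromℕ d ℚ.≤ v ℚ.* fromℕ 2
    exponent-above k v 1≤k h =
      let w , wd≡2v = divide (v ℚ.* fromℕ 2) 1≤d
          base : (c ^ℚ (d ℕ.* k)) ≤[ n ^ v ℚ.* fromℕ (k ℕ.+ k) ]
          base = ≤^-base 1≤n v (k ℕ.+ k) (^-nonNeg (d ℕ.* k) 0≤c)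
            (≡.subst (λ N → (c ^ℚ (d ℕ.* k)) ≤[ N ^ v ]) (≡.sym (ℕ.^-distribˡ-+-* n k k)) h)
          root : c ≤[ n ^ w ]
          root = ≤^-root 1≤n w (d ℕ.* k) (ℕ.*-mono-≤ 1≤d 1≤k) 0≤c
            (≡.subst (λ x → (c ^ℚ (d ℕ.* k)) ≤[ n ^ x ]) (rescale w wd≡2v) base)
          s⁺<w : s⁺ ℚ.< w
          s⁺<w = ℚ.≰⇒> λ w≤s⁺ → n^s⁺<c (≤^-monoʳ 1≤n w s⁺ w≤s⁺ root)
      in ≡.subst (s⁺ ℚ.* fromℕ d ℚ.≤_) wd≡2v
           (ℚ.*-monoʳ-≤-nonNeg (fromℕ d) {{ℚ.nonNegative (fromℕ-nonNeg d)}} (ℚ.<⇒≤ s⁺<w))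
      where
      rescale : ∀ w → w ℚ.* fromℕ d ≡ v ℚ.* fromℕ 2 → v ℚ.* fromℕ (k ℕ.+ k) ≡ w ℚ.* fromℕ (d ℕ.* k)
      rescale w wd≡2v = begin
        v ℚ.* fromℕ (k ℕ.+ k)          ≡⟨ ≡.cong (λ x → v ℚ.* fromℕ (k ℕ.+ x)) (ℕ.+-identityʳ k) ⟨
        v ℚ.* fromℕ (2 ℕ.* k)          ≡⟨ ≡.cong (v ℚ.*_) (fromℕ-* 2 k) ⟩
        v ℚ.* (fromℕ 2 ℚ.* fromℕ k)    ≡⟨ ℚ.*-assoc v (fromℕ 2) (fromℕ k) ⟨
        v ℚ.* fromℕ 2 ℚ.* fromℕ k      ≡⟨ ≡.cong (ℚ._* fromℕ k) wd≡2v ⟨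
        w ℚ.* fromℕ d ℚ.* fromℕ k      ≡⟨ ℚ.*-assoc w (fromℕ d) (fromℕ k) ⟩
        w ℚ.* (fromℕ d ℚ.* fromℕ k)    ≡⟨ ≡.cong (w ℚ.*_) (fromℕ-* d k) ⟨
        w ℚ.* fromℕ (d ℕ.* k)          ∎
        where open ≡.≡-Reasoning

    -- Lowering the base from `q₂` to `c` absorbs `C`: from `p C = q₂^(dk) > C c^(dk)` follows
    -- `p > c^(dk)`, and `p` is already below `N ^ β`.
    exponent-from-real : ∀ {β} C k → 1 ℕ.≤ k → (C · ((n ℕ.^ k ℕ.* n ℕ.^ k) ^ β)) ∋ (q₂ ^ℚ (d ℕ.* k)) →
      fromℕ C ℚ.* c ^ℚ (d ℕ.* k) ℚ.< q₂ ^ℚ (d ℕ.* k) → ∃[ v ] (β ∋ v × s⁺ ℚ.* fromℕ d ℚ.≤ v ℚ.* fromℕ 2)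
    exponent-from-real {β} C k 1≤k CN^β∋ Cc^dk<q₂^dk = from-multiple (·-∋⁻ C (^-nonNeg (d ℕ.* k) (ℚ.<⇒≤ 0<q₂)) CN^β∋)
      where
      N = n ℕ.^ k ℕ.* n ℕ.^ k
      from-power : ∀ {p} → c ^ℚ (d ℕ.* k) ℚ.< p → 1 ℕ.≤ N × ∃[ q ] ∃[ v ] (p ℚ.< q × β ∋ v × q ≤[ N ^ v ]) →
                   ∃[ v ] (β ∋ v × s⁺ ℚ.* fromℕ d ℚ.≤ v ℚ.* fromℕ 2)
      from-power c^dk<p (1≤N , q , v , p<q , β∋v , q≤N^v) =
        v , β∋v , exponent-above k v 1≤k (≤^-monoˡ 1≤N v (ℚ.<⇒≤ (ℚ.<-trans c^dk<p p<q)) q≤N^v)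
      from-multiple : ∃[ p ] (p ℚ.* fromℕ C ≡ q₂ ^ℚ (d ℕ.* k) × (N ^ β) ∋ p) →
                      ∃[ v ] (β ∋ v × s⁺ ℚ.* fromℕ d ℚ.≤ v ℚ.* fromℕ 2)
      from-multiple (p , pC≡q₂^dk , N^β∋p) =
        from-power c^dk<p (^-∋⁻ N (ℚ.≤-trans (^-nonNeg (d ℕ.* k) 0≤c) (ℚ.<⇒≤ c^dk<p)) N^β∋p)
        where
        c^dk<p : c ^ℚ (d ℕ.* k) ℚ.< p
        c^dk<p = ℚ.*-cancelʳ-<-nonNeg (fromℕ C) {{ℚ.nonNegative (fromℕ-nonNeg C)}}
          (≡.subst₂ ℚ._<_ (ℚ.*-comm (fromℕ C) (c ^ℚ (d ℕ.* k))) (≡.sym pC≡q₂^dk) Cc^dk<q₂^dk)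

    rank-bound-above : ∀ {β v} → RankBound (K d) β → v ℚ.* fromℕ 2 ℚ.< s⁺ ℚ.* fromℕ d → β ∋ v
    rank-bound-above {β} {v} (C , N₀ , bound) 2v<s⁺d =
      at-scale (R-lower (ℚ.<⇒≤ 0<q₂) q₂<q₁ ρ∋q₁) (scaled-power-< (fromℕ C) 0<c c<q₂)
      where
      at-scale : ∃[ N ] (∀ k → N ℕ.< k → q₂ ^ℚ k ℚ.< fromℕ (R k)) →
                 ∃[ k₀ ] (∀ k → k₀ ℕ.≤ k → fromℕ C ℚ.* c ^ℚ k ℚ.< q₂ ^ℚ k) → β ∋ v
      at-scale (N , lower) (k₀ , Cc^j<q₂^j) = conclude (exponent-from-real {β} C k (ℕ.s≤s ℕ.z≤n)
        (from-rank (bound (n ℕ.^ k ℕ.* n ℕ.^ k) (ℕ.≤-trans N₀≤k k≤n^k*n^k)))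
        (Cc^j<q₂^j (d ℕ.* k) (ℕ.≤-trans k₀≤k (k≤d*k k))))
        where
        -- Beyond three thresholds: that of the limit, that of the rank bound (as `k ≤ n^(2k)`), and
        -- the one from which `C` is absorbed.
        k = suc (N ℕ.+ (N₀ ℕ.+ k₀))
        N₀≤k : N₀ ℕ.≤ k
        N₀≤k = ℕ.m≤n⇒m≤1+n (ℕ.≤-trans (ℕ.m≤m+n N₀ k₀) (ℕ.m≤n+m (N₀ ℕ.+ k₀) N))
        k₀≤k : k₀ ℕ.≤ k
        k₀≤k = ℕ.m≤n⇒m≤1+n (ℕ.≤-trans (ℕ.m≤n+m k₀ N₀) (ℕ.m≤n+m (N₀ ℕ.+ k₀) N))
        k≤n^k*n^k : k ℕ.≤ n ℕ.^ k ℕ.* n ℕ.^ k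
        k≤n^k*n^k = ≡.subst (ℕ._≤ n ℕ.^ k ℕ.* n ℕ.^ k) (ℕ.*-identityʳ k)
          (ℕ.*-mono-≤ (k≤n^k 2≤n k) (ℕ.>-nonZero⁻¹ (n ℕ.^ k) {{ℕ.m^n≢0 n k {{ℕ.>-nonZero 1≤n}}}}))
        from-rank : ∃[ r ] (IsRank (graphTensor (K d) (n ℕ.^ k ℕ.* n ℕ.^ k)) r ×
                            fromℚ (fromℕ r) ≤ C · ((n ℕ.^ k ℕ.* n ℕ.^ k) ^ β)) →
                    (C · ((n ℕ.^ k ℕ.* n ℕ.^ k) ^ β)) ∋ (q₂ ^ℚ (d ℕ.* k))
        from-rank (r , (hd , _) , r≤CN^β) = r≤CN^β (q₂ ^ℚ (d ℕ.* k))
          (ℚ.<-≤-trans (lower (d ℕ.* k) (ℕ.≤-trans (ℕ.s≤s (ℕ.m≤m+n N _)) (k≤d*k k))) (fromℕ-mono-≤ (R-upper k hd)))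
        conclude : ∃[ v′ ] (β ∋ v′ × s⁺ ℚ.* fromℕ d ℚ.≤ v′ ℚ.* fromℕ 2) → β ∋ v
        conclude (v′ , β∋v′ , s⁺d≤2v′) = ℝ.lower β
          (ℚ.*-cancelʳ-<-nonNeg (fromℕ 2) {{ℚ.nonNegative (fromℕ-nonNeg 2)}} (ℚ.<-≤-trans 2v<s⁺d s⁺d≤2v′)) β∋v′

    -- The real `s⁺ d / 2` is a lower bound of all admissible `β`, hence at most their infimum; the
    -- strict inequality for `u` makes it a member of that cut.
    ω-above : ∀ {ω u} → Isω (K d) ω → u ℚ.* fromℕ 2 ℚ.< s⁺ ℚ.* fromℕ d → ω ∋ u
    ω-above {ω} {u} (_ , greatest) 2u<s⁺d =
      let u⁺ , 2u⁺≡s⁺d = divide (s⁺ ℚ.* fromℕ d) {2} (ℕ.s≤s ℕ.z≤n)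
      in greatest (fromℚ u⁺)
           (λ β bound v v<u⁺ → rank-bound-above bound
             (≡.subst (v ℚ.* fromℕ 2 ℚ.<_) 2u⁺≡s⁺d (ℚ.*-monoˡ-<-pos (fromℕ 2) v<u⁺)))
           u (ℚ.*-cancelʳ-<-nonNeg (fromℕ 2) (≡.subst (u ℚ.* fromℕ 2 ℚ.<_) (≡.sym 2u⁺≡s⁺d) 2u<s⁺d))

  2E≡dD : fromℕ E ℚ.* fromℕ 2 ≡ fromℕ D ℚ.* fromℕ d
  2E≡dD = begin
    fromℕ E ℚ.* fromℕ 2   ≡⟨ ℚ.*-comm (fromℕ E) (fromℕ 2) ⟩
    fromℕ 2 ℚ.* fromℕ E   ≡⟨ fromℕ-* 2 E ⟨
    fromℕ (2 ℕ.* E)       ≡⟨ ≡.cong fromℕ (≡.trans (2*size d) (ℕ.*-comm d D)) ⟩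
    fromℕ (D ℕ.* d)       ≡⟨ fromℕ-* D d ⟩
    fromℕ D ℚ.* fromℕ d   ∎
    where open ≡.≡-Reasoning

  module _ {τ} (isτ : Isτ (K d) τ) where

    private
      ω = proj₁ isτ

    Dτ-∋ : ∀ t → ω ∋ (t ℚ.* fromℕ E) → (D · τ) ∋ (t ℚ.* fromℕ D)
    Dτ-∋ t ω∋ = ·-∋⁺ 1≤D (proj₂ (proj₂ (proj₂ isτ)) t (/-∋⁺ 1≤E ω∋))

    ρ≤power-1 : n ≡ 1 → ∀ {q q₁} → 0ℚ ℚ.≤ q → q ℚ.< q₁ → ρ ∋ q₁ → (n ^ (D · τ)) ∋ q
    ρ≤power-1 ≡.refl 0≤q q<q₁ ρ∋q₁ = let s , Dτ∋s = ℝ.inhabited (D · τ) in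
      -- Any exponent below `D · τ` will do, because all powers of `1` equal `1`.
      1ℚ , s , ρ≤1 ≡.refl 0≤q q<q₁ ρ∋q₁ , Dτ∋s , 1≤1^ s

    -- This is where `d - 1` enters: with `t = s / (d - 1)`, the threshold `s d / 2` for `ω` is `t`
    -- times the number of edges, so it becomes `t` for `τ`.
    2tE : ∀ t {s} → t ℚ.* fromℕ D ≡ s → t ℚ.* fromℕ E ℚ.* fromℕ 2 ≡ s ℚ.* fromℕ d
    2tE t {s} tD≡s = begin
      t ℚ.* fromℕ E ℚ.* fromℕ 2     ≡⟨ ℚ.*-assoc t (fromℕ E) (fromℕ 2) ⟩
      t ℚ.* (fromℕ E ℚ.* fromℕ 2)   ≡⟨ ≡.cong (t ℚ.*_) 2E≡dD ⟩
      t ℚ.* (fromℕ D ℚ.* fromℕ d)   ≡⟨ ℚ.*-assoc t (fromℕ D) (fromℕ d) ⟨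
      t ℚ.* fromℕ D ℚ.* fromℕ d     ≡⟨ ≡.cong (ℚ._* fromℕ d) tD≡s ⟩
      s ℚ.* fromℕ d                 ∎
      where open ≡.≡-Reasoning

    ρ≤power-2 : 2 ℕ.≤ n → ∀ {q q₁} → 0ℚ ℚ.≤ q → q ℚ.< q₁ → ρ ∋ q₁ → (n ^ (D · τ)) ∋ q
    ρ≤power-2 2≤n {q} {q₁} 0≤q q<q₁ ρ∋q₁ = between (ℚ.<-dense q<q₁)
      where
      at-gap : ∀ {q₂} → q₂ ℚ.< q₁ → PowerGap n q q₂ → (n ^ (D · τ)) ∋ q
      at-gap {q₂} q₂<q₁ gap = at-exponent (divide s 1≤D)
        where
        open PowerGap gap
        at-exponent : ∃[ t ] t ℚ.* fromℕ D ≡ s → (n ^ (D · τ)) ∋ q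
        at-exponent (t , tD≡s) = ^-∋⁺ {x = D · τ} {q′ = a} {s} 1≤n q<a (≡.subst ((D · τ) ∋_) tD≡s (Dτ-∋ t ω∋tE)) a≤n^s
          where
          ω∋tE : ω ∋ (t ℚ.* fromℕ E)
          ω∋tE = ω-above 2≤n {c} {s⁺} {q₂} {q₁} 0<c n^s⁺<c c<q₂ q₂<q₁ ρ∋q₁
            {ω} {t ℚ.* fromℕ E} (proj₁ (proj₂ isτ)) (≡.subst (ℚ._< s⁺ ℚ.* fromℕ d) (≡.sym (2tE t tD≡s))
              (ℚ.*-monoˡ-<-pos (fromℕ d) {{ℚ.positive (fromℕ-pos 1≤d)}} s<s⁺))
      -- The gap from `q₂` to `q₁` is spent on the limit, the one from `q` to `q₂` on the exponents.
      between : ∃[ q₂ ] (q ℚ.< q₂ × q₂ ℚ.< q₁) → (n ^ (D · τ)) ∋ q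
      between (q₂ , q<q₂ , q₂<q₁) = at-gap q₂<q₁ (power-gap 2≤n 0≤q q<q₂)

    ρ≤power : ρ ≤ n ^ (D · τ)
    ρ≤power q ρ∋q = by-sign (q ℚ.<? 0ℚ)
      where
      by-size : ∃[ q₁ ] (q ℚ.< q₁ × ρ ∋ q₁) → 0ℚ ℚ.≤ q → 1 ℕ.< n ⊎ 1 ≡ n → (n ^ (D · τ)) ∋ q
      by-size (q₁ , q<q₁ , ρ∋q₁) 0≤q (inj₁ 2≤n) = ρ≤power-2 2≤n 0≤q q<q₁ ρ∋q₁
      by-size (q₁ , q<q₁ , ρ∋q₁) 0≤q (inj₂ 1≡n) = ρ≤power-1 (≡.sym 1≡n) 0≤q q<q₁ ρ∋q₁
      by-sign : Dec (q ℚ.< 0ℚ) → (n ^ (D · τ)) ∋ q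
      -- A negative `q` lies below `0`, which is below every power by convention.
      by-sign (yes q<0) = let s , Dτ∋s = ℝ.inhabited (D · τ) in
        ^-∋⁺ {x = D · τ} {q′ = 0ℚ} {s} 1≤n q<0 Dτ∋s (inj₁ ℚ.≤-refl)
      by-sign (no q≮0) = by-size (ℝ.rounded ρ ρ∋q) (ℚ.≮⇒≥ q≮0) (ℕ.m≤n⇒m<n∨m≡n 1≤n)

lemma20 : ∀ {c ℓ₁ ℓ₂} (F : HeytingField c ℓ₁ ℓ₂) → let open Tensors F in
    ∀ (d n : ℕ) → 3 ℕ.≤ d → 1 ℕ.≤ n →
    ∀ (T : Tensor {d} (λ _ → Fin n)) →
    ∀ (ρ τ : ℝ) → IsAsymptoticRank T ρ → Isτ (K d) τ →
    ρ ≤ n ^ ((d ∸ 1) · τ)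
lemma20 F d n 3≤d 1≤n T ρ τ asymptotic isτ = AsymptoticBound.ρ≤power F 3≤d 1≤n T {ρ} asymptotic {τ} isτ
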